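{- Let $H\in\mathrm{GL}_3(\mathbb{C})$ be a hermitian matrix and let $SU_3(H)=\{g\in \mathrm{SL}_3(\mathbb{C})\mid \bar g' H g=H\}$ be the associated special unitary group. Let $R\in SU_3(H)$ be a reflection. Then $R$ is not contained in any global division algebra $(D,\alpha)$ of degree three with involution $\alpha$ of the second kind such that $SU(D_v)\cong SU_3(H)$ for some infinite place $v$. That is: for every quadratic extension $E/F$ of number fields, every central division algebra $D$ of degree three over $E$ with an involution $\alpha$ of the second kind (with respect to $E/F$), every infinite place $v$ of $F$ and every isomorphism $\varphi: SU(D_v)\to SU_3(H)$, one has $R\notin\varphi(SU(D))$. Similarly, no hermitian or skew-hermitian element of $SU_3(H)$ other than the identity arises in this way, i.e. lies in such an image $\varphi(SU(D))$.
   Context: $\bar g'$ denotes the conjugate transpose of $g$. Let $\tau$ be the non-trivial element of $\mathrm{Gal}(E/F)$. An involution of the second kind on $D$ is a ring anti-automorphism $\alpha$ of $D$ with $\alpha\circ\alpha=\mathrm{id}$ and $\alpha|_E=\tau$. Put $SU(D)=\{g\in D^\times\mid\alpha(g)g=1,\ \mathrm{N}_{rd}(g)=1\}$, where $\mathrm{N}_{rd}$ is the reduced norm. For a place $v$ of $F$ put $D_v=D\otimes_F F_v$ with the involution induced by $\alpha$, and let $SU(D_v)$ be the group of $g\in D_v^\times$ with $\alpha(g)g=1$ and reduced norm $1$; $SU(D)$ is regarded as a subgroup of $SU(D_v)$. A reflection is an element $R\ne 1$ with $R^2=1$. An element $g\in SU_3(H)$ is hermitian (respectively skew-hermitian) if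 $g^*=g$ (respectively $g^*=-g$), where $g^*=H^{ -1}\bar g'H$ is the adjoint involution attached to $H$. -}

module Defs where

open import Level using (0ℓ)
open import Algebra.Bundles using (Ring; CommutativeRing; Group; AbelianGroup)
import Algebra.Construct.Flip.Op as Op
open import Algebra.Morphism.Bundles using (RingHomomorphism)
import Algebra.Morphism.Construct.Composition as Composition
open import Algebra.Morphism.Structures using (IsRingIsomorphism)
import Algebra.Properties.AbelianGroup
import Algebra.Properties.CommutativeSemigroup
import Algebra.Properties.Ring
import Algebra.Properties.Semiring.Sum
import Algebra.Solver.Ring.NaturalCoefficients.Default as NaturalCoefficients
open import Data.Fin.Base using (Fin; zero; suc)
open import Data.Fin.Patterns using (0F; 1F; 2F)
open import Data.Nat.Base as ℕ using (ℕ)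
import Data.Nat.Properties as ℕ
open import Data.Product.Base using (Σ; ∃; _×_; _,_; proj₁; proj₂)
open import Data.Rational.Base as ℚ using (ℚ; 0ℚ; 1ℚ; ½)
import Data.Rational.Properties as ℚ
import Data.Rational.Solver as ℚ
open import Data.Sum.Base using (inj₁; inj₂)
open import Relation.Binary.PropositionalEquality.Core as ≡ using (_≡_)
import Relation.Binary.Reasoning.Setoid as SetoidReasoning
open import Relation.Nullary.Negation.Core using (¬_)

2ℚ : ℚ
2ℚ = 1ℚ ℚ.+ 1ℚ

private
  0<1 : 0ℚ ℚ.< 1ℚ
  0<1 = ℚ.positive⁻¹ 1ℚ

  half : ℚ → ℚ
  half ε = ½ ℚ.* ε

  half-pos : ∀ {ε} → 0ℚ ℚ.< ε → 0ℚ ℚ.< half ε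
  half-pos {ε} p = ≡.subst (ℚ._< half ε) (ℚ.*-zeroʳ ½) (ℚ.*-monoʳ-<-pos ½ p)

  half-double : ∀ ε → 2ℚ ℚ.* half ε ≡ ε
  half-double ε = ≡.trans (≡.sym (ℚ.*-assoc 2ℚ ½ ε)) (ℚ.*-identityˡ ε)

  pos-* : ∀ {p q} → 0ℚ ℚ.< p → 0ℚ ℚ.< q → 0ℚ ℚ.< p ℚ.* q
  pos-* {p} {q} 0<p 0<q =
    ≡.subst (ℚ._< p ℚ.* q) (ℚ.*-zeroʳ p) (ℚ.*-monoʳ-<-pos p {{ℚ.positive 0<p}} 0<q)

  <-+ˡ : ∀ {p q} → 0ℚ ℚ.< q → p ℚ.≤ p ℚ.+ q
  <-+ˡ {p} {q} 0<q = ≡.subst (ℚ._≤ p ℚ.+ q) (ℚ.+-identityʳ p) (ℚ.+-monoʳ-≤ p (ℚ.<⇒≤ 0<q))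

  divide : ∀ {ε B} → 0ℚ ℚ.< ε → 0ℚ ℚ.< B → ∃ λ δ → 0ℚ ℚ.< δ × B ℚ.* δ ≡ ε
  divide {ε} {B} 0<ε 0<B = (ℚ.1/ B) {{nz}} ℚ.* ε , pos-* 0<1/B 0<ε , eq
    where
    nz = ℚ.pos⇒nonZero B {{ℚ.positive 0<B}}
    0<1/B = ℚ.positive⁻¹ ((ℚ.1/ B) {{nz}}) {{ℚ.1/pos⇒pos B {{ℚ.positive 0<B}}}}
    eq : B ℚ.* ((ℚ.1/ B) {{nz}} ℚ.* ε) ≡ ε
    eq = ≡.trans (≡.sym (ℚ.*-assoc B _ ε))
           (≡.trans (≡.cong (ℚ._* ε) (ℚ.*-inverseʳ B {{nz}})) (ℚ.*-identityˡ ε))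

-- ∥ x ∥< ε stands for |x| < ε, where |·| is an absolute value on A and ε is a
-- positive rational.  The triangle inequality is only needed in the weak form
-- +-bound, which for |z|² = re² + im² requires no square roots.

record Gauge (A : CommutativeRing 0ℓ 0ℓ) : Set₁ where
  open CommutativeRing A
  infix 4 ∥_∥<_
  field
    ∥_∥<_   : Carrier → ℚ → Set
    resp    : ∀ {x y ε} → x ≈ y → ∥ x ∥< ε → ∥ y ∥< ε
    mono    : ∀ {x ε δ} → 0ℚ ℚ.< ε → ε ℚ.≤ δ → ∥ x ∥< ε → ∥ x ∥< δ
    0-bound : ∀ {ε} → 0ℚ ℚ.< ε → ∥ 0# ∥< ε
    bounded : ∀ x → ∃ λ ε → 0ℚ ℚ.< ε × ∥ x ∥< ε
    -‿bound : ∀ {x ε} → ∥ x ∥< ε → ∥ - x ∥< ε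
    +-bound : ∀ {x y ε} → 0ℚ ℚ.< ε → ∥ x ∥< ε → ∥ y ∥< ε → ∥ x + y ∥< 2ℚ ℚ.* ε
    *-bound : ∀ {x y ε δ} → 0ℚ ℚ.< ε → 0ℚ ℚ.< δ →
              ∥ x ∥< ε → ∥ y ∥< δ → ∥ x * y ∥< ε ℚ.* δ

-- The completion of A with respect to |·|: Cauchy sequences modulo null sequences.
module Completion (A : CommutativeRing 0ℓ 0ℓ) (gauge : Gauge A) where
  private module A = CommutativeRing A
  open A using (_-_)
  open Gauge gauge

  record CauchySequence : Set where
    field
      at     : ℕ → A.Carrier
      cauchy : ∀ ε → 0ℚ ℚ.< ε →
               ∃ λ N → ∀ m n → N ℕ.≤ m → N ℕ.≤ n → ∥ at m - at n ∥< ε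

  open CauchySequence public

  infix 4 _≈_
  record _≈_ (x y : CauchySequence) : Set where
    constructor lim
    field
      null : ∀ ε → 0ℚ ℚ.< ε → ∃ λ N → ∀ n → N ℕ.≤ n → ∥ at x n - at y n ∥< ε

  open _≈_ public

  private
    open import Algebra.Properties.Ring A.ring using (-‿involutive; -‿+-comm; x[y-z]≈xy-xz; [y-z]x≈yx-zx)

    x≈y⇒x-y≈0 : ∀ {x y} → x A.≈ y → A.0# A.≈ x - y
    x≈y⇒x-y≈0 {x} {y} e = A.trans (A.sym (A.-‿inverseʳ y)) (A.+-congʳ (A.sym e))

    swap : ∀ x y → A.- (x - y) A.≈ y - x
    swap x y = begin
      A.- (x - y)             ≈⟨ -‿+-comm x (A.- y) ⟨
      A.- x A.+ A.- (A.- y)   ≈⟨ A.+-congˡ (-‿involutive y) ⟩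
      A.- x A.+ y             ≈⟨ A.+-comm _ _ ⟩
      y - x                   ∎
      where
      open SetoidReasoning A.setoid

    telescope : ∀ x y z → (x - y) A.+ (y - z) A.≈ x - z
    telescope x y z = begin
      (x - y) A.+ (y - z)           ≈⟨ A.+-assoc _ _ _ ⟩
      x A.+ (A.- y A.+ (y - z))     ≈⟨ A.+-congˡ (A.+-assoc _ _ _) ⟨
      x A.+ ((A.- y A.+ y) - z)     ≈⟨ A.+-congˡ (A.+-congʳ (A.-‿inverseˡ y)) ⟩
      x A.+ (A.0# - z)              ≈⟨ A.+-congˡ (A.+-identityˡ _) ⟩
      x - z                         ∎
      where open SetoidReasoning A.setoid

    interchange : ∀ x y z w → (x - y) A.+ (z - w) A.≈ (x A.+ z) - (y A.+ w)
    interchange x y z w = begin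
      (x - y) A.+ (z - w)           ≈⟨ solve 4 (λ x y z w → (x :+ y) :+ (z :+ w) := (x :+ z) :+ (y :+ w)) A.refl x (A.- y) z (A.- w) ⟩
      (x A.+ z) A.+ (A.- y - w)     ≈⟨ A.+-congˡ (-‿+-comm y w) ⟩
      (x A.+ z) - (y A.+ w)         ∎
      where
      open SetoidReasoning A.setoid
      open NaturalCoefficients A.commutativeSemiring

    product : ∀ x y z w → x A.* (z - w) A.+ (x - y) A.* w A.≈ x A.* z - y A.* w
    product x y z w = A.trans (A.+-cong (x[y-z]≈xy-xz x z w) ([y-z]x≈yx-zx w x y))
                              (telescope (x A.* z) (x A.* w) (y A.* w))

    sum-small : ∀ {ε x y} → 0ℚ ℚ.< ε → ∥ x ∥< half ε → ∥ y ∥< half ε → ∥ x A.+ y ∥< ε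
    sum-small {ε} 0<ε p q = ≡.subst (∥ _ ∥<_) (half-double ε) (+-bound (half-pos 0<ε) p q)

    product-small : ∀ {ε B C} → 0ℚ ℚ.< ε → (0<B : 0ℚ ℚ.< B) (0<C : 0ℚ ℚ.< C) → ∃ λ δ → 0ℚ ℚ.< δ ×
      (∀ {x y z w} → ∥ x ∥< B → ∥ w ∥< C → ∥ x - y ∥< δ → ∥ z - w ∥< δ →
       ∥ x A.* z - y A.* w ∥< ε)
    product-small {ε} {B} {C} 0<ε 0<B 0<C with divide (half-pos 0<ε) (ℚ.+-mono-< 0<B 0<C)
    ... | δ , 0<δ , eq = δ , 0<δ , λ {x} {y} {z} {w} bx bw xy zw →
      resp (product x y z w) (sum-small 0<ε
        (≡.subst (∥ _ ∥<_) eq (*-bound 0<B+C 0<δ (mono 0<B (<-+ˡ 0<C) bx) zw))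
        (≡.subst (∥ _ ∥<_) (≡.trans (ℚ.*-comm δ (B ℚ.+ C)) eq) (*-bound 0<δ 0<B+C xy
          (mono 0<C (≡.subst (C ℚ.≤_) (ℚ.+-comm C B) (<-+ˡ 0<B)) bw))))
      where 0<B+C = ℚ.+-mono-< 0<B 0<C

    eventually-bounded : ∀ x → ∃ λ B → 0ℚ ℚ.< B × ∃ λ N → ∀ n → N ℕ.≤ n → ∥ at x n ∥< B
    eventually-bounded x with cauchy x 1ℚ 0<1
    ... | N , c with bounded (at x N)
    ...   | C , 0<C , b = 2ℚ ℚ.* (1ℚ ℚ.+ C) , pos-* (ℚ.+-mono-< 0<1 0<1) 0<1+C , N , λ n N≤n →
      resp (A.trans (A.+-assoc _ _ _) (A.trans (A.+-congˡ (A.-‿inverseˡ _)) (A.+-identityʳ _)))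
        (+-bound 0<1+C (mono 0<1 (<-+ˡ 0<C) (c n N N≤n ℕ.≤-refl))
                       (mono 0<C (≡.subst (C ℚ.≤_) (ℚ.+-comm C 1ℚ) (<-+ˡ 0<1)) b))
      where 0<1+C = ℚ.+-mono-< 0<1 0<C

  pointwise : ∀ {x y} → (∀ n → at x n A.≈ at y n) → x ≈ y
  pointwise e = lim λ ε 0<ε → 0 , λ n _ → resp (x≈y⇒x-y≈0 (e n)) (0-bound 0<ε)

  private

    ≈-refl : ∀ {x} → x ≈ x
    ≈-refl = pointwise λ _ → A.refl

    ≈-sym : ∀ {x y} → x ≈ y → y ≈ x
    ≈-sym (lim e) = lim λ ε 0<ε → let N , p = e ε 0<ε in
      N , λ n N≤n → resp (swap _ _) (-‿bound (p n N≤n))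

    ≈-trans : ∀ {x y z} → x ≈ y → y ≈ z → x ≈ z
    ≈-trans (lim e) (lim f) = lim λ ε 0<ε →
      let N , p = e (half ε) (half-pos 0<ε)
          M , q = f (half ε) (half-pos 0<ε)
      in N ℕ.⊔ M , λ n le → resp (telescope _ _ _)
           (sum-small 0<ε (p n (ℕ.≤-trans (ℕ.m≤m⊔n N M) le)) (q n (ℕ.≤-trans (ℕ.m≤n⊔m N M) le)))

  infixl 6 _+_
  _+_ : CauchySequence → CauchySequence → CauchySequence
  at (x + y) n = at x n A.+ at y n
  cauchy (x + y) ε 0<ε =
    let N , p = cauchy x (half ε) (half-pos 0<ε)
        M , q = cauchy y (half ε) (half-pos 0<ε)
    in N ℕ.⊔ M , λ m n le₁ le₂ → resp (interchange _ _ _ _)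
         (sum-small 0<ε
           (p m n (ℕ.≤-trans (ℕ.m≤m⊔n N M) le₁) (ℕ.≤-trans (ℕ.m≤m⊔n N M) le₂))
           (q m n (ℕ.≤-trans (ℕ.m≤n⊔m N M) le₁) (ℕ.≤-trans (ℕ.m≤n⊔m N M) le₂)))

  infix 8 -_
  -_ : CauchySequence → CauchySequence
  at (- x) n = A.- at x n
  cauchy (- x) ε 0<ε = let N , p = cauchy x ε 0<ε in
    N , λ m n le₁ le₂ → resp (A.sym (-‿+-comm _ _)) (-‿bound (p m n le₁ le₂))

  infixl 7 _*_
  _*_ : CauchySequence → CauchySequence → CauchySequence
  at (x * y) n = at x n A.* at y n
  cauchy (x * y) ε 0<ε =
    let B , 0<B , N₁ , bx = eventually-bounded x
        C , 0<C , N₂ , by = eventually-bounded y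
        δ , 0<δ , small   = product-small 0<ε 0<B 0<C
        N₃ , cx = cauchy x δ 0<δ
        N₄ , cy = cauchy y δ 0<δ
        N = (N₁ ℕ.⊔ N₂) ℕ.⊔ (N₃ ℕ.⊔ N₄)
        l₁ = ℕ.≤-trans (ℕ.m≤m⊔n N₁ N₂) (ℕ.m≤m⊔n _ _)
        l₂ = ℕ.≤-trans (ℕ.m≤n⊔m N₁ N₂) (ℕ.m≤m⊔n _ _)
        l₃ = ℕ.≤-trans (ℕ.m≤m⊔n N₃ N₄) (ℕ.m≤n⊔m (N₁ ℕ.⊔ N₂) _)
        l₄ = ℕ.≤-trans (ℕ.m≤n⊔m N₃ N₄) (ℕ.m≤n⊔m (N₁ ℕ.⊔ N₂) _)
    in N , λ m n le₁ le₂ → small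
         (bx m (ℕ.≤-trans l₁ le₁)) (by n (ℕ.≤-trans l₂ le₂))
         (cx m n (ℕ.≤-trans l₃ le₁) (ℕ.≤-trans l₃ le₂))
         (cy m n (ℕ.≤-trans l₄ le₁) (ℕ.≤-trans l₄ le₂))

  constant : A.Carrier → CauchySequence
  at (constant a) _ = a
  cauchy (constant a) ε 0<ε = 0 , λ _ _ _ _ → resp (x≈y⇒x-y≈0 A.refl) (0-bound 0<ε)

  private
    +-cong : ∀ {x y z w} → x ≈ y → z ≈ w → x + z ≈ y + w
    +-cong (lim e) (lim f) = lim λ ε 0<ε →
      let N , p = e (half ε) (half-pos 0<ε)
          M , q = f (half ε) (half-pos 0<ε)
      in N ℕ.⊔ M , λ n le → resp (interchange _ _ _ _)
           (sum-small 0<ε (p n (ℕ.≤-trans (ℕ.m≤m⊔n N M) le)) (q n (ℕ.≤-trans (ℕ.m≤n⊔m N M) le)))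

    -‿cong : ∀ {x y} → x ≈ y → - x ≈ - y
    -‿cong (lim e) = lim λ ε 0<ε → let N , p = e ε 0<ε in
      N , λ n le → resp (A.sym (-‿+-comm _ _)) (-‿bound (p n le))

    *-cong : ∀ {x y z w} → x ≈ y → z ≈ w → x * z ≈ y * w
    *-cong {x} {y} {z} {w} (lim e) (lim f) = lim λ ε 0<ε →
      let B , 0<B , N₁ , bx = eventually-bounded x
          C , 0<C , N₂ , bw = eventually-bounded w
          δ , 0<δ , small   = product-small 0<ε 0<B 0<C
          N₃ , cx = e δ 0<δ
          N₄ , cy = f δ 0<δ
          N = (N₁ ℕ.⊔ N₂) ℕ.⊔ (N₃ ℕ.⊔ N₄)
          l₁ = ℕ.≤-trans (ℕ.m≤m⊔n N₁ N₂) (ℕ.m≤m⊔n _ _)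
          l₂ = ℕ.≤-trans (ℕ.m≤n⊔m N₁ N₂) (ℕ.m≤m⊔n _ _)
          l₃ = ℕ.≤-trans (ℕ.m≤m⊔n N₃ N₄) (ℕ.m≤n⊔m (N₁ ℕ.⊔ N₂) _)
          l₄ = ℕ.≤-trans (ℕ.m≤n⊔m N₃ N₄) (ℕ.m≤n⊔m (N₁ ℕ.⊔ N₂) _)
      in N , λ n le → small
           (bx n (ℕ.≤-trans l₁ le)) (bw n (ℕ.≤-trans l₂ le))
           (cx n (ℕ.≤-trans l₃ le)) (cy n (ℕ.≤-trans l₄ le))

  commutativeRing : CommutativeRing 0ℓ 0ℓ
  commutativeRing = record
    { Carrier = CauchySequence
    ; _≈_ = _≈_
    ; _+_ = _+_
    ; _*_ = _*_
    ; -_ = -_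
    ; 0# = constant A.0#
    ; 1# = constant A.1#
    ; isCommutativeRing = record
      { isRing = record
        { +-isAbelianGroup = record
          { isGroup = record
            { isMonoid = record
              { isSemigroup = record
                { isMagma = record
                  { isEquivalence = record { refl = ≈-refl ; sym = ≈-sym ; trans = ≈-trans }
                  ; ∙-cong = +-cong
                  }
                ; assoc = λ _ _ _ → pointwise λ _ → A.+-assoc _ _ _
                }
              ; identity = (λ _ → pointwise λ _ → A.+-identityˡ _)
                         , (λ _ → pointwise λ _ → A.+-identityʳ _)
              }
            ; inverse = (λ _ → pointwise λ _ → A.-‿inverseˡ _)
                      , (λ _ → pointwise λ _ → A.-‿inverseʳ _)
            ; ⁻¹-cong = -‿cong
            }
          ; comm = λ _ _ → pointwise λ _ → A.+-comm _ _
          }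
        ; *-cong = *-cong
        ; *-assoc = λ _ _ _ → pointwise λ _ → A.*-assoc _ _ _
        ; *-identity = (λ _ → pointwise λ _ → A.*-identityˡ _)
                     , (λ _ → pointwise λ _ → A.*-identityʳ _)
        ; distrib = (λ _ _ _ → pointwise λ _ → A.distribˡ _ _ _)
                  , (λ _ _ _ → pointwise λ _ → A.distribʳ _ _ _)
        }
      ; *-comm = λ _ _ → pointwise λ _ → A.*-comm _ _
      }
    }

  constant-homomorphism : RingHomomorphism A.rawRing (CommutativeRing.rawRing commutativeRing)
  constant-homomorphism = record
    { ⟦_⟧ = constant
    ; isRingHomomorphism = record
      { isSemiringHomomorphism = record
        { isNearSemiringHomomorphism = record
          { +-isMonoidHomomorphism = record
            { isMagmaHomomorphism = record
              { isRelHomomorphism = record { cong = λ e → pointwise λ _ → e }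
              ; homo = λ _ _ → pointwise λ _ → A.refl
              }
            ; ε-homo = ≈-refl
            }
          ; *-homo = λ _ _ → pointwise λ _ → A.refl
          }
        ; 1#-homo = ≈-refl
        }
      ; -‿homo = λ _ → pointwise λ _ → A.refl
      }
    }

private
  2*-mono : ∀ {a b ε} → a ℚ.< ε → b ℚ.< ε → a ℚ.+ b ℚ.< 2ℚ ℚ.* ε
  2*-mono {a} {b} {ε} p q = ≡.subst (a ℚ.+ b ℚ.<_)
    (≡.sym (≡.trans (ℚ.*-distribʳ-+ ε 1ℚ 1ℚ) (≡.cong₂ ℚ._+_ (ℚ.*-identityˡ ε) (ℚ.*-identityˡ ε))))
    (ℚ.+-mono-< p q)

  *-mono-<-nonNeg : ∀ {a b ε δ} → 0ℚ ℚ.≤ a → 0ℚ ℚ.< δ → a ℚ.< ε → b ℚ.< δ → a ℚ.* b ℚ.< ε ℚ.* δ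
  *-mono-<-nonNeg {a} {b} {ε} {δ} 0≤a 0<δ p q = ℚ.≤-<-trans
    (ℚ.*-monoˡ-≤-nonNeg a {{ℚ.nonNegative 0≤a}} (ℚ.<⇒≤ q))
    (ℚ.*-monoˡ-<-pos δ {{ℚ.positive 0<δ}} p)

ℚ-gauge : Gauge ℚ.+-*-commutativeRing
ℚ-gauge = record
  { ∥_∥<_   = λ x ε → ℚ.∣ x ∣ ℚ.< ε
  ; resp    = λ { ≡.refl p → p }
  ; mono    = λ _ ε≤δ p → ℚ.<-≤-trans p ε≤δ
  ; 0-bound = λ 0<ε → 0<ε
  ; bounded = λ x → 1ℚ ℚ.+ ℚ.∣ x ∣
                  , ℚ.+-mono-<-≤ (ℚ.positive⁻¹ 1ℚ) (ℚ.0≤∣p∣ x)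
                  , ≡.subst (ℚ._< 1ℚ ℚ.+ ℚ.∣ x ∣) (ℚ.+-identityˡ ℚ.∣ x ∣) (ℚ.+-monoˡ-< ℚ.∣ x ∣ (ℚ.positive⁻¹ 1ℚ))
  ; -‿bound = λ {x} → ≡.subst (ℚ._< _) (≡.sym (ℚ.∣-p∣≡∣p∣ x))
  ; +-bound = λ {x} {y} _ p q → ℚ.≤-<-trans (ℚ.∣p+q∣≤∣p∣+∣q∣ x y) (2*-mono p q)
  ; *-bound = λ {x} {y} _ 0<δ p q → ≡.subst (ℚ._< _) (≡.sym (ℚ.∣p*q∣≡∣p∣*∣q∣ x y))
                (*-mono-<-nonNeg (ℚ.0≤∣p∣ x) 0<δ p q)
  }

module ℝ = Completion ℚ.+-*-commutativeRing ℚ-gauge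

ℝ : CommutativeRing 0ℓ 0ℓ
ℝ = ℝ.commutativeRing

-- The strict order of ℝ; the gap q′ < q makes it invariant under ≈.
infix 4 _<ℝ_
_<ℝ_ : ℝ.CauchySequence → ℚ → Set
x <ℝ q = ∃ λ q′ → q′ ℚ.< q × ∃ λ N → ∀ n → N ℕ.≤ n → ℝ.at x n ℚ.≤ q′

-- A[i] for a commutative ring A, on pairs (re , im).

module Gaussian (A : CommutativeRing 0ℓ 0ℓ) where
  private module A = CommutativeRing A
  open A using (_-_)

  record Carrier : Set where
    constructor _+i_
    field re im : A.Carrier
  open Carrier public

  infix 4 _≈_
  record _≈_ (z w : Carrier) : Set where
    constructor eq
    field
      re-≈ : re z A.≈ re w
      im-≈ : im z A.≈ im w
  open _≈_ public

  infixl 6 _+_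
  infixl 7 _*_
  infix 8 -_


  _+_ _*_ : Carrier → Carrier → Carrier
  (a +i b) + (c +i d) = (a A.+ c) +i (b A.+ d)
  (a +i b) * (c +i d) = (a A.* c - b A.* d) +i (a A.* d A.+ b A.* c)

  -_ conj : Carrier → Carrier
  - (a +i b)    = (A.- a) +i (A.- b)
  conj (a +i b) = a +i (A.- b)

  normSq : Carrier → A.Carrier
  normSq (a +i b) = a A.* a A.+ b A.* b

  private
    open Algebra.Properties.Ring A.ring using (-1*x≈-x; -‿distribˡ-*; -‿distribʳ-*; -‿+-comm; -0#≈0#; -‿involutive)
    open NaturalCoefficients A.commutativeSemiring
    m = A.- A.1#

    re-lemma : ∀ a b c d → a A.* c - b A.* d A.≈ a A.* c A.+ m A.* (b A.* d)
    re-lemma a b c d = A.+-congˡ (A.sym (-1*x≈-x _))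

    infixl 7 _⊛_
    _⊛_ : Carrier → Carrier → Carrier
    (a +i b) ⊛ (c +i d) = (a A.* c A.+ m A.* (b A.* d)) +i (a A.* d A.+ b A.* c)

    *≈⊛ : ∀ z w → z * w ≈ z ⊛ w
    *≈⊛ (a +i b) (c +i d) = eq (re-lemma a b c d) A.refl

    ≈-refl : ∀ {z} → z ≈ z
    ≈-refl = eq A.refl A.refl
    ≈-sym : ∀ {z w} → z ≈ w → w ≈ z
    ≈-sym (eq p q) = eq (A.sym p) (A.sym q)
    ≈-trans : ∀ {x y z} → x ≈ y → y ≈ z → x ≈ z
    ≈-trans (eq p q) (eq r s) = eq (A.trans p r) (A.trans q s)

    +-cong : ∀ {x y z w} → x ≈ y → z ≈ w → (x + z) ≈ (y + w)
    +-cong (eq p q) (eq r s) = eq (A.+-cong p r) (A.+-cong q s)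

    *-cong : ∀ {x y z w} → x ≈ y → z ≈ w → (x * z) ≈ (y * w)
    *-cong (eq p q) (eq r s) = eq
      (A.+-cong (A.*-cong p r) (A.-‿cong (A.*-cong q s)))
      (A.+-cong (A.*-cong p s) (A.*-cong q r))

    ⊛-cong : ∀ {x y z w} → x ≈ y → z ≈ w → (x ⊛ z) ≈ (y ⊛ w)
    ⊛-cong p q = ≈-trans (≈-sym (*≈⊛ _ _)) (≈-trans (*-cong p q) (*≈⊛ _ _))

    ⊛-assoc : ∀ x y z → (x ⊛ y) ⊛ z ≈ x ⊛ (y ⊛ z)
    ⊛-assoc (a +i b) (c +i d) (e +i f) = eq
      (solve 7 (λ m a b c d e f →
          (a :* c :+ m :* (b :* d)) :* e :+ m :* ((a :* d :+ b :* c) :* f)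
       := a :* (c :* e :+ m :* (d :* f)) :+ m :* (b :* (c :* f :+ d :* e))) A.refl m a b c d e f)
      (solve 7 (λ m a b c d e f →
          (a :* c :+ m :* (b :* d)) :* f :+ (a :* d :+ b :* c) :* e
       := a :* (c :* f :+ d :* e) :+ b :* (c :* e :+ m :* (d :* f))) A.refl m a b c d e f)

    *-assoc : ∀ x y z → ((x * y) * z) ≈ (x * (y * z))
    *-assoc x y z = ≈-trans (≈-trans (*≈⊛ (x * y) z) (⊛-cong (*≈⊛ x y) ≈-refl))
      (≈-trans (⊛-assoc x y z)
      (≈-sym (≈-trans (*≈⊛ x (y * z)) (⊛-cong ≈-refl (*≈⊛ y z)))))

    *-comm : ∀ x y → (x * y) ≈ (y * x)
    *-comm (a +i b) (c +i d) = eq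
      (A.+-cong (A.*-comm a c) (A.-‿cong (A.*-comm b d)))
      (A.trans (A.+-comm _ _) (A.+-cong (A.*-comm b c) (A.*-comm a d)))

    *-identityˡ : ∀ x → ((A.1# +i A.0#) * x) ≈ x
    *-identityˡ (a +i b) = ≈-trans (*≈⊛ (A.1# +i A.0#) (a +i b)) (eq
      (solve 3 (λ m a b → con 1 :* a :+ m :* (con 0 :* b) := a) A.refl m a b)
      (solve 2 (λ a b → con 1 :* b :+ con 0 :* a := b) A.refl a b))

    distribˡ : ∀ x y z → (x * (y + z)) ≈ ((x * y) + (x * z))
    distribˡ x@(a +i b) y@(c +i d) z@(e +i f) = ≈-trans (*≈⊛ x (y + z)) (≈-trans (eq
      (solve 7 (λ m a b c d e f → a :* (c :+ e) :+ m :* (b :* (d :+ f))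
        := (a :* c :+ m :* (b :* d)) :+ (a :* e :+ m :* (b :* f))) A.refl m a b c d e f)
      (solve 6 (λ a b c d e f → a :* (d :+ f) :+ b :* (c :+ e)
        := (a :* d :+ b :* c) :+ (a :* f :+ b :* e)) A.refl a b c d e f))
      (+-cong (≈-sym (*≈⊛ x y)) (≈-sym (*≈⊛ x z))))

  commutativeRing : CommutativeRing 0ℓ 0ℓ
  commutativeRing = record
    { Carrier = Carrier
    ; _≈_ = _≈_
    ; _+_ = _+_
    ; _*_ = _*_
    ; -_ = -_
    ; 0# = A.0# +i A.0#
    ; 1# = A.1# +i A.0#
    ; isCommutativeRing = record
      { isRing = record
        { +-isAbelianGroup = record
          { isGroup = record
            { isMonoid = record
              { isSemigroup = record
                { isMagma = record
                  { isEquivalence = record { refl = ≈-refl ; sym = ≈-sym ; trans = ≈-trans }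
                  ; ∙-cong = +-cong
                  }
                ; assoc = λ _ _ _ → eq (A.+-assoc _ _ _) (A.+-assoc _ _ _)
                }
              ; identity = (λ _ → eq (A.+-identityˡ _) (A.+-identityˡ _))
                         , (λ _ → eq (A.+-identityʳ _) (A.+-identityʳ _))
              }
            ; inverse = (λ _ → eq (A.-‿inverseˡ _) (A.-‿inverseˡ _))
                      , (λ _ → eq (A.-‿inverseʳ _) (A.-‿inverseʳ _))
            ; ⁻¹-cong = λ (eq p q) → eq (A.-‿cong p) (A.-‿cong q)
            }
          ; comm = λ _ _ → eq (A.+-comm _ _) (A.+-comm _ _)
          }
        ; *-cong = *-cong
        ; *-assoc = *-assoc
        ; *-identity = *-identityˡ
                     , (λ x → ≈-trans (*-comm x _) (*-identityˡ x))
        ; distrib = distribˡ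
                  , (λ x y z → ≈-trans (*-comm (y + z) x) (≈-trans (distribˡ x y z)
                       (+-cong (*-comm x y) (*-comm x z))))
        }
      ; *-comm = *-comm
      }
    }

  private module G = CommutativeRing commutativeRing

  normSq-cong : ∀ {z w} → z ≈ w → normSq z A.≈ normSq w
  normSq-cong (eq p q) = A.+-cong (A.*-cong p p) (A.*-cong q q)

  conj-homomorphism : RingHomomorphism G.rawRing G.rawRing
  conj-homomorphism = record
    { ⟦_⟧ = conj
    ; isRingHomomorphism = record
      { isSemiringHomomorphism = record
        { isNearSemiringHomomorphism = record
          { +-isMonoidHomomorphism = record
            { isMagmaHomomorphism = record
              { isRelHomomorphism = record { cong = λ (eq p q) → eq p (A.-‿cong q) }
              ; homo = λ _ _ → eq A.refl (A.sym (-‿+-comm _ _))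
              }
            ; ε-homo = eq A.refl -0#≈0#
            }
          ; *-homo = λ (a +i b) (c +i d) → eq
              (A.+-congˡ (A.-‿cong (A.trans (A.sym (-‿involutive _))
                (A.trans (A.-‿cong (-‿distribˡ-* b d)) (-‿distribʳ-* (A.- b) d)))))
              (A.trans (A.sym (-‿+-comm _ _)) (A.+-cong (-‿distribʳ-* a d) (-‿distribˡ-* b c)))
          }
        ; 1#-homo = eq A.refl -0#≈0#
        }
      ; -‿homo = λ _ → ≈-refl
      }
    }

module ℂ = Gaussian ℝ

ℂ : CommutativeRing 0ℓ 0ℓ
ℂ = ℂ.commutativeRing

private
  p≤∣p∣ : ∀ p → p ℚ.≤ ℚ.∣ p ∣
  p≤∣p∣ p with ℚ.≤-total 0ℚ p
  ... | inj₁ 0≤p = ℚ.≤-reflexive (≡.sym (ℚ.0≤p⇒∣p∣≡p 0≤p))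
  ... | inj₂ p≤0 = ℚ.≤-trans p≤0 (ℚ.0≤∣p∣ p)

  <ℝ-resp : ∀ {x y q} → x ℝ.≈ y → x <ℝ q → y <ℝ q
  <ℝ-resp {x} {y} {q} (ℝ.lim null) (q′ , q′<q , N , p) =
    q″ , q″<q , N ℕ.⊔ M , λ n le → bound n (ℕ.≤-trans (ℕ.m≤m⊔n N M) le) (ℕ.≤-trans (ℕ.m≤n⊔m N M) le)
    where
    d = ℚ.<-dense q′<q
    q″ = proj₁ d
    q′<q″ = proj₁ (proj₂ d)
    q″<q = proj₂ (proj₂ d)
    ε = q″ ℚ.- q′
    0<ε : 0ℚ ℚ.< ε
    0<ε = ≡.subst (ℚ._< ε) (ℚ.+-inverseʳ q′) (ℚ.+-monoˡ-< (ℚ.- q′) q′<q″)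
    M = proj₁ (null ε 0<ε)
    small = proj₂ (null ε 0<ε)
    open ℚ.+-*-Solver
    open ℚ.≤-Reasoning
    bound : ∀ n → N ℕ.≤ n → M ℕ.≤ n → ℝ.at y n ℚ.≤ q″
    bound n N≤n M≤n = begin
      b                          ≡⟨ solve 2 (λ a b → b := a :+ (:- (a :+ :- b))) ≡.refl a b ⟩
      a ℚ.+ (ℚ.- (a ℚ.- b))      ≤⟨ ℚ.+-mono-≤ (p n N≤n) (ℚ.≤-trans (p≤∣p∣ (ℚ.- (a ℚ.- b)))
                                       (ℚ.≤-reflexive (ℚ.∣-p∣≡∣p∣ (a ℚ.- b)))) ⟩
      q′ ℚ.+ ℚ.∣ a ℚ.- b ∣       ≤⟨ ℚ.+-monoʳ-≤ q′ (ℚ.<⇒≤ (small n M≤n)) ⟩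
      q′ ℚ.+ (q″ ℚ.- q′)         ≡⟨ solve 2 (λ q r → q :+ (r :+ :- q) := r) ≡.refl q′ q″ ⟩
      q″                         ∎
      where
      a = ℝ.at x n
      b = ℝ.at y n

  sq-nonNeg : ∀ p → 0ℚ ℚ.≤ p ℚ.* p
  sq-nonNeg p = ≡.subst (0ℚ ℚ.≤_) eq (ℚ.0≤∣p∣ (p ℚ.* p))
    where
    eq : ℚ.∣ p ℚ.* p ∣ ≡ p ℚ.* p
    eq with ℚ.≤-total 0ℚ p
    ... | inj₁ 0≤p = ≡.trans (ℚ.∣p*q∣≡∣p∣*∣q∣ p p) (≡.cong₂ ℚ._*_ (ℚ.0≤p⇒∣p∣≡p 0≤p) (ℚ.0≤p⇒∣p∣≡p 0≤p))
    ... | inj₂ p≤0 = ≡.trans (≡.cong ℚ.∣_∣ neg-sq) (≡.trans (ℚ.∣p*q∣≡∣p∣*∣q∣ (ℚ.- p) (ℚ.- p))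
                       (≡.trans (≡.cong₂ ℚ._*_ e e) (≡.sym neg-sq)))
      where
      open ℚ.+-*-Solver
      neg-sq : p ℚ.* p ≡ (ℚ.- p) ℚ.* (ℚ.- p)
      neg-sq = solve 1 (λ p → p :* p := (:- p) :* (:- p)) ≡.refl p
      e : ℚ.∣ ℚ.- p ∣ ≡ ℚ.- p
      e = ℚ.0≤p⇒∣p∣≡p (ℚ.neg-antimono-≤ p≤0)

  sum-sq-nonNeg : ∀ p q → 0ℚ ℚ.≤ p ℚ.* p ℚ.+ q ℚ.* q
  sum-sq-nonNeg p q = ℚ.+-mono-≤ (sq-nonNeg p) (sq-nonNeg q)

  sq-mono : ∀ {ε δ} → 0ℚ ℚ.< ε → ε ℚ.≤ δ → ε ℚ.* ε ℚ.≤ δ ℚ.* δ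
  sq-mono {ε} {δ} 0<ε ε≤δ = ℚ.≤-trans
    (ℚ.*-monoˡ-≤-nonNeg ε {{ℚ.nonNegative (ℚ.<⇒≤ 0<ε)}} ε≤δ)
    (ℚ.*-monoʳ-≤-nonNeg δ {{ℚ.nonNegative (ℚ.≤-trans (ℚ.<⇒≤ 0<ε) ε≤δ)}} ε≤δ)

  sq-pos : ∀ {ε} → 0ℚ ℚ.< ε → 0ℚ ℚ.< ε ℚ.* ε
  sq-pos 0<ε = pos-* 0<ε 0<ε

-- |x| < ε in the sense that |σ(x)|² < ε², for σ : A → ℂ.
embedding-gauge : (A : CommutativeRing 0ℓ 0ℓ) →
  RingHomomorphism (CommutativeRing.rawRing A) (CommutativeRing.rawRing ℂ) → Gauge A
embedding-gauge A σ = record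
  { ∥_∥<_   = λ x ε → ℂ.normSq (σ.⟦ x ⟧) <ℝ ε ℚ.* ε
  ; resp    = λ e → <ℝ-resp (ℂ.normSq-cong (σ.⟦⟧-cong e))
  ; mono    = λ 0<ε ε≤δ (q , q<ε² , p) → q , ℚ.<-≤-trans q<ε² (sq-mono 0<ε ε≤δ) , p
  ; 0-bound = λ 0<ε → <ℝ-resp (ℂ.normSq-cong (ℂ.commutativeRing .CommutativeRing.sym σ.0#-homo))
                (0ℚ , sq-pos 0<ε , 0 , λ _ _ → ℚ.≤-refl)
  ; bounded = λ x → bounded (ℂ.normSq σ.⟦ x ⟧)
  ; -‿bound = λ {x} {ε} b → <ℝ-resp (ℂ.normSq-cong (CommutativeRing.sym ℂ (σ.-‿homo x))) (neg-bound σ.⟦ x ⟧ b)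
  ; +-bound = λ {x} {y} {ε} 0<ε p q → <ℝ-resp (ℂ.normSq-cong (CommutativeRing.sym ℂ (σ.+-homo x y)))
                (add-bound σ.⟦ x ⟧ σ.⟦ y ⟧ {ε} p q)
  ; *-bound = λ {x} {y} 0<ε 0<δ p q → <ℝ-resp (ℂ.normSq-cong (CommutativeRing.sym ℂ (σ.*-homo x y)))
                (mul-bound σ.⟦ x ⟧ σ.⟦ y ⟧ 0<ε 0<δ p q)
  }
  where
  module σ = RingHomomorphism σ

  bounded : ∀ (r : ℝ.CauchySequence) → ∃ λ ε → 0ℚ ℚ.< ε × r <ℝ ε ℚ.* ε
  bounded r with ℝ.cauchy r 1ℚ (ℚ.positive⁻¹ 1ℚ)
  ... | N , c = B , 0<B , C , C<B² , N , λ n le → bound n (c n N le ℕ.≤-refl)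
    where
    open ℚ.+-*-Solver
    a = ℚ.∣ ℝ.at r N ∣
    C = 1ℚ ℚ.+ a
    B = 1ℚ ℚ.+ C
    0<C : 0ℚ ℚ.< C
    0<C = ℚ.+-mono-<-≤ 0<1 (ℚ.0≤∣p∣ (ℝ.at r N))
    0<B : 0ℚ ℚ.< B
    0<B = ℚ.+-mono-< 0<1 0<C
    C<B² : C ℚ.< B ℚ.* B
    C<B² = ≡.subst₂ ℚ._<_ (ℚ.+-identityʳ C)
      (solve 1 (λ c → c :+ (con 1ℚ :+ c :+ c :* c) := (con 1ℚ :+ c) :* (con 1ℚ :+ c)) ≡.refl C)
      (ℚ.+-monoʳ-< C (ℚ.+-mono-< (ℚ.+-mono-< 0<1 0<C) (sq-pos 0<C)))
    bound : ∀ n → ℚ.∣ ℝ.at r n ℚ.- ℝ.at r N ∣ ℚ.< 1ℚ → ℝ.at r n ℚ.≤ C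
    bound n lt = ≡.subst (ℚ._≤ C)
      (solve 2 (λ x y → (x :+ :- y) :+ y := x) ≡.refl (ℝ.at r n) (ℝ.at r N))
      (ℚ.+-mono-≤ (ℚ.≤-trans (p≤∣p∣ _) (ℚ.<⇒≤ lt)) (p≤∣p∣ _))

  neg-bound : ∀ z {q} → ℂ.normSq z <ℝ q → ℂ.normSq (ℂ.- z) <ℝ q
  neg-bound (a ℂ.+i b) (q′ , lt , N , p) = q′ , lt , N , λ n le →
    ≡.subst (ℚ._≤ q′) (solve 2 (λ x y → x :* x :+ y :* y := (:- x) :* (:- x) :+ (:- y) :* (:- y))
      ≡.refl (ℝ.at a n) (ℝ.at b n)) (p n le)
    where open ℚ.+-*-Solver

  -- |z + w|² ≤ |z + w|² + |z - w|² = 2 |z|² + 2 |w|²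
  add-bound : ∀ z w {ε} → ℂ.normSq z <ℝ ε ℚ.* ε → ℂ.normSq w <ℝ ε ℚ.* ε →
              ℂ.normSq (z ℂ.+ w) <ℝ (2ℚ ℚ.* ε) ℚ.* (2ℚ ℚ.* ε)
  add-bound (a ℂ.+i b) (c ℂ.+i d) {ε} (q , q<ε² , N , p) (r , r<ε² , M , s) =
    2ℚ ℚ.* (q ℚ.+ r)
    , ≡.subst (2ℚ ℚ.* (q ℚ.+ r) ℚ.<_)
        (solve 1 (λ e → con 2ℚ :* (con 2ℚ :* (e :* e)) := (con 2ℚ :* e) :* (con 2ℚ :* e)) ≡.refl ε)
        (ℚ.*-monoʳ-<-pos 2ℚ (2*-mono q<ε² r<ε²))
    , N ℕ.⊔ M , λ n le → bound (ℝ.at a n) (ℝ.at b n) (ℝ.at c n) (ℝ.at d n)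
        (p n (ℕ.≤-trans (ℕ.m≤m⊔n N M) le)) (s n (ℕ.≤-trans (ℕ.m≤n⊔m N M) le))
    where
    open ℚ.+-*-Solver
    bound : ∀ a b c d → a ℚ.* a ℚ.+ b ℚ.* b ℚ.≤ q → c ℚ.* c ℚ.+ d ℚ.* d ℚ.≤ r →
            (a ℚ.+ c) ℚ.* (a ℚ.+ c) ℚ.+ (b ℚ.+ d) ℚ.* (b ℚ.+ d) ℚ.≤ 2ℚ ℚ.* (q ℚ.+ r)
    bound a b c d p s = begin
      z+w                         ≡⟨ ℚ.+-identityʳ z+w ⟨
      z+w ℚ.+ 0ℚ                  ≤⟨ ℚ.+-monoʳ-≤ z+w (sum-sq-nonNeg (a ℚ.- c) (b ℚ.- d)) ⟩
      z+w ℚ.+ ((a ℚ.- c) ℚ.* (a ℚ.- c) ℚ.+ (b ℚ.- d) ℚ.* (b ℚ.- d))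
        ≡⟨ solve 4 (λ a b c d →
             ((a :+ c) :* (a :+ c) :+ (b :+ d) :* (b :+ d)) :+
             ((a :+ :- c) :* (a :+ :- c) :+ (b :+ :- d) :* (b :+ :- d))
             := con 2ℚ :* ((a :* a :+ b :* b) :+ (c :* c :+ d :* d))) ≡.refl a b c d ⟩
      2ℚ ℚ.* ((a ℚ.* a ℚ.+ b ℚ.* b) ℚ.+ (c ℚ.* c ℚ.+ d ℚ.* d))
        ≤⟨ ℚ.*-monoˡ-≤-nonNeg 2ℚ (ℚ.+-mono-≤ p s) ⟩
      2ℚ ℚ.* (q ℚ.+ r)            ∎
      where
      open ℚ.≤-Reasoning
      z+w = (a ℚ.+ c) ℚ.* (a ℚ.+ c) ℚ.+ (b ℚ.+ d) ℚ.* (b ℚ.+ d)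

  mul-bound : ∀ z w {ε δ} → 0ℚ ℚ.< ε → 0ℚ ℚ.< δ → ℂ.normSq z <ℝ ε ℚ.* ε → ℂ.normSq w <ℝ δ ℚ.* δ →
              ℂ.normSq (z ℂ.* w) <ℝ (ε ℚ.* δ) ℚ.* (ε ℚ.* δ)
  mul-bound (a ℂ.+i b) (c ℂ.+i d) {ε} {δ} 0<ε 0<δ (q , q<ε² , N , p) (r , r<δ² , M , s) =
    q ℚ.* r
    , ≡.subst (q ℚ.* r ℚ.<_)
        (solve 2 (λ e d → (e :* e) :* (d :* d) := (e :* d) :* (e :* d)) ≡.refl ε δ)
        (*-mono-<-nonNeg 0≤q (sq-pos 0<δ) q<ε² r<δ²)
    , N ℕ.⊔ M , λ n le → bound (ℝ.at a n) (ℝ.at b n) (ℝ.at c n) (ℝ.at d n)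
        (p n (ℕ.≤-trans (ℕ.m≤m⊔n N M) le)) (s n (ℕ.≤-trans (ℕ.m≤n⊔m N M) le))
    where
    open ℚ.+-*-Solver
    0≤q : 0ℚ ℚ.≤ q
    0≤q = ℚ.≤-trans (sum-sq-nonNeg (ℝ.at a N) (ℝ.at b N)) (p N ℕ.≤-refl)
    bound : ∀ a b c d → a ℚ.* a ℚ.+ b ℚ.* b ℚ.≤ q → c ℚ.* c ℚ.+ d ℚ.* d ℚ.≤ r →
            (a ℚ.* c ℚ.- b ℚ.* d) ℚ.* (a ℚ.* c ℚ.- b ℚ.* d) ℚ.+
            (a ℚ.* d ℚ.+ b ℚ.* c) ℚ.* (a ℚ.* d ℚ.+ b ℚ.* c) ℚ.≤ q ℚ.* r
    bound a b c d p s = begin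
      (a ℚ.* c ℚ.- b ℚ.* d) ℚ.* (a ℚ.* c ℚ.- b ℚ.* d) ℚ.+ (a ℚ.* d ℚ.+ b ℚ.* c) ℚ.* (a ℚ.* d ℚ.+ b ℚ.* c)
        ≡⟨ solve 4 (λ a b c d → (a :* c :+ :- (b :* d)) :* (a :* c :+ :- (b :* d)) :+
             (a :* d :+ b :* c) :* (a :* d :+ b :* c)
             := (a :* a :+ b :* b) :* (c :* c :+ d :* d)) ≡.refl a b c d ⟩
      (a ℚ.* a ℚ.+ b ℚ.* b) ℚ.* (c ℚ.* c ℚ.+ d ℚ.* d)
        ≤⟨ ℚ.*-monoˡ-≤-nonNeg (a ℚ.* a ℚ.+ b ℚ.* b) {{ℚ.nonNegative (sum-sq-nonNeg a b)}} s ⟩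
      (a ℚ.* a ℚ.+ b ℚ.* b) ℚ.* r
        ≤⟨ ℚ.*-monoʳ-≤-nonNeg r {{ℚ.nonNegative (ℚ.≤-trans (sum-sq-nonNeg c d) s)}} p ⟩
      q ℚ.* r ∎
      where open ℚ.≤-Reasoning

infix 4 _⟶_
_⟶_ : Ring 0ℓ 0ℓ → Ring 0ℓ 0ℓ → Set
A ⟶ B = RingHomomorphism (Ring.rawRing A) (Ring.rawRing B)

open RingHomomorphism public using (⟦_⟧)

ring : CommutativeRing 0ℓ 0ℓ → Ring 0ℓ 0ℓ
ring = CommutativeRing.ring

infixr 9 _⊚_
_⊚_ : ∀ {A B C} → B ⟶ C → A ⟶ B → A ⟶ C
_⊚_ {C = C} g f = record
  { ⟦_⟧ = λ x → ⟦ g ⟧ (⟦ f ⟧ x)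
  ; isRingHomomorphism = Composition.isRingHomomorphism (Ring.trans C)
      (RingHomomorphism.isRingHomomorphism f) (RingHomomorphism.isRingHomomorphism g)
  }

-- Preservation of 0 and negatives is automatic.
mkHom : ∀ {A B} (let module A = Ring A; module B = Ring B) (f : A.Carrier → B.Carrier) →
  (∀ {x y} → x A.≈ y → f x B.≈ f y) →
  (∀ x y → f (x A.+ y) B.≈ f x B.+ f y) →
  (∀ x y → f (x A.* y) B.≈ f x B.* f y) →
  f A.1# B.≈ B.1# → A ⟶ B
mkHom {A} {B} f f-cong f-+ f-* f-1 = record
  { ⟦_⟧ = f
  ; isRingHomomorphism = record
    { isSemiringHomomorphism = record
      { isNearSemiringHomomorphism = record
        { +-isMonoidHomomorphism = record
          { isMagmaHomomorphism = record
            { isRelHomomorphism = record { cong = f-cong }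
            ; homo = f-+
            }
          ; ε-homo = f-0
          }
        ; *-homo = f-*
        }
      ; 1#-homo = f-1
      }
    ; -‿homo = λ x → +-uniqueˡ _ _ (B.trans (B.sym (f-+ _ x)) (B.trans (f-cong (A.-‿inverseˡ x)) f-0))
    }
  }
  where
  module A = Ring A
  module B = Ring B
  open Algebra.Properties.AbelianGroup B.+-abelianGroup
    using (identityˡ-unique) renaming (inverseˡ-unique to +-uniqueˡ)
  f-0 : f A.0# B.≈ B.0#
  f-0 = identityˡ-unique _ _ (B.trans (B.sym (f-+ A.0# A.0#)) (f-cong (A.+-identityˡ A.0#)))

module _ (C : CommutativeRing 0ℓ 0ℓ) where
  private module C = CommutativeRing C
  open Algebra.Properties.Semiring.Sum C.semiring
    using (sum; sum-syntax; sum-cong-≋; ∑-distrib-+; ∑-comm; *-distribˡ-sum; *-distribʳ-sum)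

  Matrix : ℕ → Set
  Matrix n = Fin n → Fin n → C.Carrier

  identityMatrix : ∀ {n} → Matrix n
  identityMatrix zero    zero    = C.1#
  identityMatrix zero    (suc _) = C.0#
  identityMatrix (suc _) zero    = C.0#
  identityMatrix (suc i) (suc j) = identityMatrix i j

  private
    sum-zero : ∀ {n} (f : Fin n → C.Carrier) → (∀ i → f i C.≈ C.0#) → sum f C.≈ C.0#
    sum-zero {ℕ.zero}  f e = C.refl
    sum-zero {ℕ.suc n} f e = C.trans (C.+-cong (e zero) (sum-zero (λ i → f (suc i)) (λ i → e (suc i))))
                                     (C.+-identityˡ C.0#)

    identity-sumˡ : ∀ {n} (i : Fin n) (f : Fin n → C.Carrier) →
      sum (λ k → identityMatrix i k C.* f k) C.≈ f i
    identity-sumˡ zero f = C.trans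
      (C.+-cong (C.*-identityˡ _) (sum-zero _ (λ k → C.zeroˡ (f (suc k))))) (C.+-identityʳ _)
    identity-sumˡ (suc i) f = C.trans
      (C.+-cong (C.zeroˡ _) (identity-sumˡ i (λ k → f (suc k)))) (C.+-identityˡ _)

    identity-sumʳ : ∀ {n} (j : Fin n) (f : Fin n → C.Carrier) →
      sum (λ k → f k C.* identityMatrix k j) C.≈ f j
    identity-sumʳ zero f = C.trans
      (C.+-cong (C.*-identityʳ _) (sum-zero _ (λ k → C.zeroʳ (f (suc k))))) (C.+-identityʳ _)
    identity-sumʳ (suc j) f = C.trans
      (C.+-cong (C.zeroʳ _) (identity-sumʳ j (λ k → f (suc k)))) (C.+-identityˡ _)

    assoc : ∀ {n} (f : Fin n → C.Carrier) (M : Matrix n) (g : Fin n → C.Carrier) →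
      sum (λ l → sum (λ k → f k C.* M k l) C.* g l) C.≈ sum (λ k → f k C.* sum (λ l → M k l C.* g l))
    assoc {n} f M g = begin
      ∑[ l < n ] ((∑[ k < n ] (f k C.* M k l)) C.* g l)    ≈⟨ sum-cong-≋ {n} (λ l → *-distribʳ-sum {n} (g l) _) ⟩
      ∑[ l < n ] (∑[ k < n ] ((f k C.* M k l) C.* g l))    ≈⟨ sum-cong-≋ {n} (λ l → sum-cong-≋ {n} (λ k → C.*-assoc _ _ _)) ⟩
      ∑[ l < n ] (∑[ k < n ] (f k C.* (M k l C.* g l)))    ≈⟨ ∑-comm (λ l k → f k C.* (M k l C.* g l)) ⟩
      ∑[ k < n ] (∑[ l < n ] (f k C.* (M k l C.* g l)))    ≈⟨ sum-cong-≋ {n} (λ k → *-distribˡ-sum {n} (f k) _) ⟨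
      ∑[ k < n ] (f k C.* (∑[ l < n ] (M k l C.* g l)))    ∎
      where open SetoidReasoning C.setoid

  matrixRing : ℕ → Ring 0ℓ 0ℓ
  matrixRing n = record
    { Carrier = Matrix n
    ; _≈_ = λ M N → ∀ i j → M i j C.≈ N i j
    ; _+_ = λ M N i j → M i j C.+ N i j
    ; _*_ = λ M N i j → ∑[ k < n ] (M i k C.* N k j)
    ; -_ = λ M i j → C.- M i j
    ; 0# = λ _ _ → C.0#
    ; 1# = identityMatrix
    ; isRing = record
      { +-isAbelianGroup = record
        { isGroup = record
          { isMonoid = record
            { isSemigroup = record
              { isMagma = record
                { isEquivalence = record
                  { refl = λ _ _ → C.refl ; sym = λ e i j → C.sym (e i j) ; trans = λ e f i j → C.trans (e i j) (f i j) }
                ; ∙-cong = λ e f i j → C.+-cong (e i j) (f i j)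
                }
              ; assoc = λ _ _ _ _ _ → C.+-assoc _ _ _
              }
            ; identity = (λ _ _ _ → C.+-identityˡ _) , (λ _ _ _ → C.+-identityʳ _)
            }
          ; inverse = (λ _ _ _ → C.-‿inverseˡ _) , (λ _ _ _ → C.-‿inverseʳ _)
          ; ⁻¹-cong = λ e i j → C.-‿cong (e i j)
          }
        ; comm = λ _ _ _ _ → C.+-comm _ _
        }
      ; *-cong = λ e f i j → sum-cong-≋ {n} (λ k → C.*-cong (e i k) (f k j))
      ; *-assoc = λ L M N i j → assoc (L i) M (λ l → N l j)
      ; *-identity = (λ M i j → identity-sumˡ i (λ k → M k j)) , (λ M i j → identity-sumʳ j (M i))
      ; distrib = (λ L M N i j → C.trans (sum-cong-≋ {n} (λ k → C.distribˡ _ _ _)) (∑-distrib-+ {n} _ _))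
                , (λ L M N i j → C.trans (sum-cong-≋ {n} (λ k → C.distribʳ _ _ _)) (∑-distrib-+ {n} _ _))
      }
    }

  conjugateTranspose : (conj : ring C ⟶ ring C) → ∀ {n} → matrixRing n ⟶ Op.ring (matrixRing n)
  conjugateTranspose conj {n} = mkHom {matrixRing n} {Op.ring (matrixRing n)} (λ M i j → conj.⟦ M j i ⟧)
    (λ e i j → conj.⟦⟧-cong (e j i))
    (λ M N i j → conj.+-homo _ _)
    (λ M N i j → C.trans (conj-sum {n} (λ k → M j k C.* N k i))
      (sum-cong-≋ {n} (λ k → C.trans (conj.*-homo _ _) (C.*-comm _ _))))
    conj-1
    where
    module conj = RingHomomorphism conj
    conj-sum : ∀ {n} (f : Fin n → C.Carrier) → conj.⟦ sum f ⟧ C.≈ sum (λ i → conj.⟦ f i ⟧)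
    conj-sum {ℕ.zero}  f = conj.0#-homo
    conj-sum {ℕ.suc n} f = C.trans (conj.+-homo _ _) (C.+-congˡ (conj-sum (λ i → f (suc i))))
    conj-1 : ∀ {n} (i j : Fin n) → conj.⟦ identityMatrix j i ⟧ C.≈ identityMatrix i j
    conj-1 zero    zero    = conj.1#-homo
    conj-1 zero    (suc j) = conj.0#-homo
    conj-1 (suc i) zero    = conj.0#-homo
    conj-1 (suc i) (suc j) = conj-1 i j

  scalar : ∀ {n} → ring C ⟶ matrixRing n
  scalar {n} = mkHom {ring C} {matrixRing n} (λ c i j → c C.* identityMatrix i j)
    (λ e i j → C.*-congʳ e)
    (λ c d i j → C.distribʳ _ _ _)
    (λ c d i j → C.sym (C.trans (sum-cong-≋ {n} (λ k → C.*-assoc c _ _))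
                 (C.trans (C.sym (*-distribˡ-sum {n} c _))
                 (C.trans (C.*-congˡ (identity-sumˡ i (λ k → d C.* identityMatrix k j)))
                 (C.sym (C.*-assoc c d _))))))
    (λ i j → C.*-identityˡ _)

  scalar-central : ∀ {n} c (M : Matrix n) (let open Ring (matrixRing n)) →
    ⟦ scalar {n} ⟧ c * M ≈ M * ⟦ scalar {n} ⟧ c
  scalar-central {n} c M i j = C.trans
    (C.trans (sum-cong-≋ {n} (λ k → C.*-assoc c _ _)) (C.trans (C.sym (*-distribˡ-sum {n} c _))
      (C.*-congˡ (identity-sumˡ i (λ k → M k j)))))
    (C.sym (C.trans (sum-cong-≋ {n} (λ k → C.trans (C.sym (C.*-assoc _ _ _))
                      (C.trans (C.*-congʳ (C.*-comm _ c)) (C.*-assoc c _ _))))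
      (C.trans (C.sym (*-distribˡ-sum {n} c _)) (C.*-congˡ (identity-sumʳ j (M i))))))

  det : Matrix 3 → C.Carrier
  det M = M 0F 0F C.* (M 1F 1F C.* M 2F 2F C.- M 1F 2F C.* M 2F 1F)
      C.- M 0F 1F C.* (M 1F 0F C.* M 2F 2F C.- M 1F 2F C.* M 2F 0F)
      C.+ M 0F 2F C.* (M 1F 0F C.* M 2F 1F C.- M 1F 1F C.* M 2F 0F)

  det-cong : ∀ {M N} → Ring._≈_ (matrixRing 3) M N → det M C.≈ det N
  det-cong e = C.+-cong (C.+-cong
    (C.*-cong (e 0F 0F) (minor (e 1F 1F) (e 2F 2F) (e 1F 2F) (e 2F 1F)))
    (C.-‿cong (C.*-cong (e 0F 1F) (minor (e 1F 0F) (e 2F 2F) (e 1F 2F) (e 2F 0F)))))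
    (C.*-cong (e 0F 2F) (minor (e 1F 0F) (e 2F 1F) (e 1F 1F) (e 2F 0F)))
    where
    minor : ∀ {x x′ y y′ z z′ w w′} → x C.≈ x′ → y C.≈ y′ → z C.≈ z′ → w C.≈ w′ →
            x C.* y C.- z C.* w C.≈ x′ C.* y′ C.- z′ C.* w′
    minor p q r s = C.+-cong (C.*-cong p q) (C.-‿cong (C.*-cong r s))

  private
    -- det M = det⁺ M - det⁻ M, with no subtraction in det⁺ and det⁻.
    det⁺ det⁻ : Matrix 3 → C.Carrier
    det⁺ M = M 0F 0F C.* (M 1F 1F C.* M 2F 2F) C.+
            (M 0F 1F C.* (M 1F 2F C.* M 2F 0F) C.+ M 0F 2F C.* (M 1F 0F C.* M 2F 1F))
    det⁻ M = M 0F 0F C.* (M 1F 2F C.* M 2F 1F) C.+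
            (M 0F 1F C.* (M 1F 0F C.* M 2F 2F) C.+ M 0F 2F C.* (M 1F 1F C.* M 2F 0F))

    open Algebra.Properties.Ring C.ring using (-‿distribʳ-*; -‿+-comm; -‿involutive; +-cancelʳ)
    open SetoidReasoning C.setoid

    cancelʳ : ∀ x y → (x C.- y) C.+ y C.≈ x
    cancelʳ x y = C.trans (C.+-assoc _ _ _) (C.trans (C.+-congˡ (C.-‿inverseˡ y)) (C.+-identityʳ x))

    det-split : ∀ M → det M C.+ det⁻ M C.≈ det⁺ M
    det-split M = begin
      a C.* (x C.- y) C.- b C.* (z C.- w) C.+ c C.* (u C.- v) C.+ (a C.* y C.+ (b C.* z C.+ c C.* v))
        ≈⟨ C.+-congʳ (C.+-congʳ (C.+-congˡ (C.trans (-‿distribʳ-* b _)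
             (C.*-congˡ (C.trans (C.sym (-‿+-comm z (C.- w))) (C.+-congˡ (-‿involutive w))))))) ⟩
      a C.* (x C.- y) C.+ b C.* (C.- z C.+ w) C.+ c C.* (u C.- v) C.+ (a C.* y C.+ (b C.* z C.+ c C.* v))
        ≈⟨ solve 12 (λ a b c x y z w u v y- z- v- →
             a :* (x :+ y-) :+ b :* (z- :+ w) :+ c :* (u :+ v-) :+ (a :* y :+ (b :* z :+ c :* v)) :=
             a :* ((x :+ y-) :+ y) :+ (b :* ((w :+ z-) :+ z) :+ c :* ((u :+ v-) :+ v)))
             C.refl a b c x y z w u v (C.- y) (C.- z) (C.- v) ⟩
      a C.* (x C.- y C.+ y) C.+ (b C.* (w C.- z C.+ z) C.+ c C.* (u C.- v C.+ v))
        ≈⟨ C.+-cong (C.*-congˡ (cancelʳ x y)) (C.+-cong (C.*-congˡ (cancelʳ w z)) (C.*-congˡ (cancelʳ u v))) ⟩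
      a C.* x C.+ (b C.* w C.+ c C.* u) ∎
      where
      open NaturalCoefficients C.commutativeSemiring
      a = M 0F 0F
      b = M 0F 1F
      c = M 0F 2F
      x = M 1F 1F C.* M 2F 2F
      y = M 1F 2F C.* M 2F 1F
      z = M 1F 0F C.* M 2F 2F
      w = M 1F 2F C.* M 2F 0F
      u = M 1F 0F C.* M 2F 1F
      v = M 1F 1F C.* M 2F 0F

    det-product : ∀ M N (let open Ring (matrixRing 3) using (_*_)) →
      det⁺ (M * N) C.+ (det⁺ M C.* det⁻ N C.+ det⁻ M C.* det⁺ N) C.≈
      det⁻ (M * N) C.+ (det⁺ M C.* det⁺ N C.+ det⁻ M C.* det⁻ N)
    det-product M N = solve 18
      (λ a b c d e f g h i a′ b′ c′ d′ e′ f′ g′ h′ i′ →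
        let P = λ a b c d e f g h i → a :* (e :* i) :+ (b :* (f :* g) :+ c :* (d :* h))
            N = λ a b c d e f g h i → a :* (f :* h) :+ (b :* (d :* i) :+ c :* (e :* g))
            D = λ a b c x y z → a :* x :+ (b :* y :+ (c :* z :+ con 0))
            on-product = λ (F : _ → _ → _ → _ → _ → _ → _ → _ → _ → Polynomial 18) →
              F (D a b c a′ d′ g′) (D a b c b′ e′ h′) (D a b c c′ f′ i′)
                (D d e f a′ d′ g′) (D d e f b′ e′ h′) (D d e f c′ f′ i′)
                (D g h i a′ d′ g′) (D g h i b′ e′ h′) (D g h i c′ f′ i′)
            PM = P a b c d e f g h i
            NM = N a b c d e f g h i
            PN = P a′ b′ c′ d′ e′ f′ g′ h′ i′
            NN = N a′ b′ c′ d′ e′ f′ g′ h′ i′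
        in (on-product P :+ (PM :* NN :+ NM :* PN)) := (on-product N :+ (PM :* PN :+ NM :* NN)))
      C.refl
      (M 0F 0F) (M 0F 1F) (M 0F 2F) (M 1F 0F) (M 1F 1F) (M 1F 2F) (M 2F 0F) (M 2F 1F) (M 2F 2F)
      (N 0F 0F) (N 0F 1F) (N 0F 2F) (N 1F 0F) (N 1F 1F) (N 1F 2F) (N 2F 0F) (N 2F 1F) (N 2F 2F)
      where open NaturalCoefficients C.commutativeSemiring

  det-* : ∀ M N → det (Ring._*_ (matrixRing 3) M N) C.≈ det M C.* det N
  det-* M N = +-cancelʳ Z (det MN) (det M C.* det N) (begin
    det MN C.+ (det⁻ MN C.+ (P C.* n C.+ p C.* Q))    ≈⟨ C.+-assoc _ _ _ ⟨
    det MN C.+ det⁻ MN C.+ (P C.* n C.+ p C.* Q)      ≈⟨ C.+-congʳ (det-split MN) ⟩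
    det⁺ MN C.+ (P C.* n C.+ p C.* Q)                 ≈⟨ det-product M N ⟩
    det⁻ MN C.+ (P C.* Q C.+ p C.* n)                 ≈⟨ C.+-congˡ (C.+-congʳ (C.*-cong (det-split M) (det-split N))) ⟨
    det⁻ MN C.+ ((x C.+ p) C.* (y C.+ n) C.+ p C.* n) ≈⟨ solve 5 (λ x y p n m →
        m :+ ((x :+ p) :* (y :+ n) :+ p :* n) := x :* y :+ (m :+ ((x :+ p) :* n :+ p :* (y :+ n))))
        C.refl x y p n (det⁻ MN) ⟩
    x C.* y C.+ (det⁻ MN C.+ ((x C.+ p) C.* n C.+ p C.* (y C.+ n)))
      ≈⟨ C.+-congˡ (C.+-congˡ (C.+-cong (C.*-congʳ (det-split M)) (C.*-congˡ (det-split N)))) ⟩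
    x C.* y C.+ Z ∎)
    where
    open NaturalCoefficients C.commutativeSemiring
    MN = Ring._*_ (matrixRing 3) M N
    x = det M
    y = det N
    P = det⁺ M
    p = det⁻ M
    Q = det⁺ N
    n = det⁻ N
    Z = det⁻ MN C.+ (P C.* n C.+ p C.* Q)

  det-1 : det identityMatrix C.≈ C.1#
  det-1 = C.trans (C.sym (C.+-identityʳ _)) (C.trans (C.+-congˡ (C.sym det⁻-1))
            (C.trans (det-split identityMatrix) det⁺-1))
    where
    open NaturalCoefficients C.commutativeSemiring
    det⁻-1 : det⁻ identityMatrix C.≈ C.0#
    det⁻-1 = solve 0 (con 1 :* (con 0 :* con 0) :+ (con 0 :* (con 0 :* con 1) :+ con 0 :* (con 1 :* con 0)) := con 0) C.refl
    det⁺-1 : det⁺ identityMatrix C.≈ C.1#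
    det⁺-1 = solve 0 (con 1 :* (con 1 :* con 1) :+ (con 0 :* (con 0 :* con 0) :+ con 0 :* (con 0 :* con 0)) := con 1) C.refl

module _ {C C′ : CommutativeRing 0ℓ 0ℓ} (h : ring C ⟶ ring C′) where
  private
    module C = CommutativeRing C
    module C′ = CommutativeRing C′
    module h = RingHomomorphism h
    open Algebra.Properties.Semiring.Sum C.semiring using (sum)
    open Algebra.Properties.Semiring.Sum C′.semiring using () renaming (sum to sum′; sum-cong-≋ to sum′-cong)

    h-sum : ∀ {n} (f : Fin n → C.Carrier) → h.⟦ sum f ⟧ C′.≈ sum′ (λ i → h.⟦ f i ⟧)
    h-sum {ℕ.zero}  f = h.0#-homo
    h-sum {ℕ.suc n} f = C′.trans (h.+-homo _ _) (C′.+-congˡ (h-sum (λ i → f (suc i))))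

    h-identity : ∀ {n} (i j : Fin n) → h.⟦ identityMatrix C i j ⟧ C′.≈ identityMatrix C′ i j
    h-identity zero    zero    = h.1#-homo
    h-identity zero    (suc j) = h.0#-homo
    h-identity (suc i) zero    = h.0#-homo
    h-identity (suc i) (suc j) = h-identity i j

  matrixMap : ∀ {n} → matrixRing C n ⟶ matrixRing C′ n
  matrixMap {n} = mkHom {matrixRing C n} {matrixRing C′ n} (λ M i j → h.⟦ M i j ⟧)
    (λ e i j → h.⟦⟧-cong (e i j))
    (λ M N i j → h.+-homo _ _)
    (λ M N i j → C′.trans (h-sum {n} _) (sum′-cong {n} (λ k → h.*-homo _ _)))
    h-identity

  matrixMap-scalar : ∀ {n} c → Ring._≈_ (matrixRing C′ n)
    (⟦ matrixMap {n} ⟧ (⟦ scalar C {n} ⟧ c)) (⟦ scalar C′ {n} ⟧ h.⟦ c ⟧)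
  matrixMap-scalar c i j = C′.trans (h.*-homo _ _) (C′.*-congˡ (h-identity i j))

  det-matrixMap : ∀ M → det C′ (⟦ matrixMap {3} ⟧ M) C′.≈ h.⟦ det C M ⟧
  det-matrixMap M = C′.sym (C′.trans (h.+-homo _ _) (C′.+-cong
    (C′.trans (h.+-homo _ _) (C′.+-cong (term _ _ _ _ _)
      (C′.trans (h.-‿homo _) (C′.-‿cong (term _ _ _ _ _)))))
    (term _ _ _ _ _)))
    where
    term : ∀ a x y z w → h.⟦ a C.* (x C.* y C.- z C.* w) ⟧ C′.≈
           h.⟦ a ⟧ C′.* (h.⟦ x ⟧ C′.* h.⟦ y ⟧ C′.- h.⟦ z ⟧ C′.* h.⟦ w ⟧)
    term a x y z w = C′.trans (h.*-homo _ _) (C′.*-congˡ (C′.trans (h.+-homo _ _)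
      (C′.+-cong (h.*-homo _ _) (C′.trans (h.-‿homo _) (C′.-‿cong (h.*-homo _ _))))))

record Algebra (k : CommutativeRing 0ℓ 0ℓ) : Set₁ where
  field
    underlying : Ring 0ℓ 0ℓ
    structure  : ring k ⟶ underlying
  open Ring underlying public
  field
    central : ∀ c x → ⟦ structure ⟧ c * x ≈ x * ⟦ structure ⟧ c

algebra : ∀ {k C} → ring k ⟶ ring C → Algebra k
algebra {C = C} f = record
  { underlying = ring C
  ; structure  = f
  ; central    = λ _ _ → CommutativeRing.*-comm C _ _
  }

restrictScalars : ∀ {k l} → ring k ⟶ ring l → Algebra l → Algebra k
restrictScalars {k} {l} f A = record
  { underlying = A.underlying
  ; structure  = _⊚_ {ring k} {ring l} {A.underlying} A.structure f
  ; central    = λ c → A.central (⟦ f ⟧ c)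
  }
  where module A = Algebra A

-- A ⊗ B as the abelian group generated by the symbols a ⊗ b, modulo
-- biadditivity and k-balancedness, with (a ⊗ b)(c ⊗ d) = ac ⊗ bd.
module Tensor {k : CommutativeRing 0ℓ 0ℓ} (A B : Algebra k) where
  private
    module k = CommutativeRing k
    module A = Algebra A
    module B = Algebra B

  infixl 6 _+_
  infix  8 -_
  infix  9 _⊗_
  data Carrier : Set where
    0#  : Carrier
    _+_ : Carrier → Carrier → Carrier
    -_  : Carrier → Carrier
    _⊗_ : A.Carrier → B.Carrier → Carrier

  infix 4 _≈_
  data _≈_ : Carrier → Carrier → Set where
    refl       : ∀ {x} → x ≈ x
    sym        : ∀ {x y} → x ≈ y → y ≈ x
    trans      : ∀ {x y z} → x ≈ y → y ≈ z → x ≈ z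
    +-cong     : ∀ {x x′ y y′} → x ≈ x′ → y ≈ y′ → x + y ≈ x′ + y′
    -‿cong     : ∀ {x x′} → x ≈ x′ → - x ≈ - x′
    +-assoc    : ∀ x y z → (x + y) + z ≈ x + (y + z)
    +-comm     : ∀ x y → x + y ≈ y + x
    +-identityˡ : ∀ x → 0# + x ≈ x
    -‿inverseˡ : ∀ x → - x + x ≈ 0#
    ⊗-cong     : ∀ {a a′ b b′} → a A.≈ a′ → b B.≈ b′ → a ⊗ b ≈ a′ ⊗ b′
    ⊗-distribʳ : ∀ a a′ b → (a A.+ a′) ⊗ b ≈ a ⊗ b + a′ ⊗ b
    ⊗-distribˡ : ∀ a b b′ → a ⊗ (b B.+ b′) ≈ a ⊗ b + a ⊗ b′
    balanced   : ∀ c a b → (a A.* ⟦ A.structure ⟧ c) ⊗ b ≈ a ⊗ (⟦ B.structure ⟧ c B.* b)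

  leftMul : A.Carrier → B.Carrier → Carrier → Carrier
  leftMul a b 0#      = 0#
  leftMul a b (x + y) = leftMul a b x + leftMul a b y
  leftMul a b (- x)   = - leftMul a b x
  leftMul a b (c ⊗ d) = (a A.* c) ⊗ (b B.* d)

  infixl 7 _*_
  _*_ : Carrier → Carrier → Carrier
  0#      * z = 0#
  (x + y) * z = x * z + y * z
  (- x)   * z = - (x * z)
  (a ⊗ b) * z = leftMul a b z

  +-abelianGroup : AbelianGroup 0ℓ 0ℓ
  +-abelianGroup = record
    { Carrier = Carrier
    ; _≈_ = _≈_
    ; _∙_ = _+_
    ; ε = 0#
    ; _⁻¹ = -_
    ; isAbelianGroup = record
      { isGroup = record
        { isMonoid = record
          { isSemigroup = record
            { isMagma = record
              { isEquivalence = record { refl = refl ; sym = sym ; trans = trans }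
              ; ∙-cong = +-cong
              }
            ; assoc = +-assoc
            }
          ; identity = +-identityˡ , λ x → trans (+-comm x 0#) (+-identityˡ x)
          }
        ; inverse = -‿inverseˡ , λ x → trans (+-comm x (- x)) (-‿inverseˡ x)
        ; ⁻¹-cong = -‿cong
        }
      ; comm = +-comm
      }
    }

  private
    open AbelianGroup +-abelianGroup using (setoid; commutativeSemigroup)
    open Algebra.Properties.AbelianGroup +-abelianGroup using () renaming (ε⁻¹≈ε to -0≈0; ⁻¹-∙-comm to -‿+-comm)
    open Algebra.Properties.CommutativeSemigroup commutativeSemigroup using (interchange)

    leftMul-cong : ∀ a b {x y} → x ≈ y → leftMul a b x ≈ leftMul a b y
    leftMul-cong a b refl = refl
    leftMul-cong a b (sym p) = sym (leftMul-cong a b p)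
    leftMul-cong a b (trans p q) = trans (leftMul-cong a b p) (leftMul-cong a b q)
    leftMul-cong a b (+-cong p q) = +-cong (leftMul-cong a b p) (leftMul-cong a b q)
    leftMul-cong a b (-‿cong p) = -‿cong (leftMul-cong a b p)
    leftMul-cong a b (+-assoc x y z) = +-assoc _ _ _
    leftMul-cong a b (+-comm x y) = +-comm _ _
    leftMul-cong a b (+-identityˡ x) = +-identityˡ _
    leftMul-cong a b (-‿inverseˡ x) = -‿inverseˡ _
    leftMul-cong a b (⊗-cong p q) = ⊗-cong (A.*-congˡ p) (B.*-congˡ q)
    leftMul-cong a b (⊗-distribʳ c c′ d) = trans (⊗-cong (A.distribˡ a c c′) B.refl) (⊗-distribʳ _ _ _)
    leftMul-cong a b (⊗-distribˡ c d d′) = trans (⊗-cong A.refl (B.distribˡ b d d′)) (⊗-distribˡ _ _ _)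
    leftMul-cong a b (balanced e c d) =
      trans (⊗-cong (A.sym (A.*-assoc a c _)) B.refl)
      (trans (balanced e (a A.* c) (b B.* d))
      (⊗-cong A.refl (B.trans (B.sym (B.*-assoc _ b d))
        (B.trans (B.*-congʳ (B.central e b)) (B.*-assoc b _ d)))))

    leftMul-⊗-cong : ∀ {a a′ b b′} → a A.≈ a′ → b B.≈ b′ → ∀ z → leftMul a b z ≈ leftMul a′ b′ z
    leftMul-⊗-cong p q 0#      = refl
    leftMul-⊗-cong p q (x + y) = +-cong (leftMul-⊗-cong p q x) (leftMul-⊗-cong p q y)
    leftMul-⊗-cong p q (- x)   = -‿cong (leftMul-⊗-cong p q x)
    leftMul-⊗-cong p q (c ⊗ d) = ⊗-cong (A.*-congʳ p) (B.*-congʳ q)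

    leftMul-distribʳ : ∀ a a′ b z → leftMul (a A.+ a′) b z ≈ leftMul a b z + leftMul a′ b z
    leftMul-distribʳ a a′ b 0#      = sym (+-identityˡ 0#)
    leftMul-distribʳ a a′ b (x + y) = trans
      (+-cong (leftMul-distribʳ a a′ b x) (leftMul-distribʳ a a′ b y)) (interchange _ _ _ _)
    leftMul-distribʳ a a′ b (- x)   = trans (-‿cong (leftMul-distribʳ a a′ b x)) (sym (-‿+-comm _ _))
    leftMul-distribʳ a a′ b (c ⊗ d) = trans (⊗-cong (A.distribʳ c a a′) B.refl) (⊗-distribʳ _ _ _)

    leftMul-distribˡ : ∀ a b b′ z → leftMul a (b B.+ b′) z ≈ leftMul a b z + leftMul a b′ z
    leftMul-distribˡ a b b′ 0#      = sym (+-identityˡ 0#)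
    leftMul-distribˡ a b b′ (x + y) = trans
      (+-cong (leftMul-distribˡ a b b′ x) (leftMul-distribˡ a b b′ y)) (interchange _ _ _ _)
    leftMul-distribˡ a b b′ (- x)   = trans (-‿cong (leftMul-distribˡ a b b′ x)) (sym (-‿+-comm _ _))
    leftMul-distribˡ a b b′ (c ⊗ d) = trans (⊗-cong A.refl (B.distribʳ d b b′)) (⊗-distribˡ _ _ _)

    leftMul-balanced : ∀ e a b z → leftMul (a A.* ⟦ A.structure ⟧ e) b z ≈ leftMul a (⟦ B.structure ⟧ e B.* b) z
    leftMul-balanced e a b 0#      = refl
    leftMul-balanced e a b (x + y) = +-cong (leftMul-balanced e a b x) (leftMul-balanced e a b y)
    leftMul-balanced e a b (- x)   = -‿cong (leftMul-balanced e a b x)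
    leftMul-balanced e a b (c ⊗ d) =
      trans (⊗-cong (A.trans (A.*-assoc a _ c)
        (A.trans (A.*-congˡ (A.central e c)) (A.sym (A.*-assoc a c _)))) B.refl)
      (trans (balanced e (a A.* c) (b B.* d)) (⊗-cong A.refl (B.sym (B.*-assoc _ b d))))

    *-congʳ : ∀ {x y} z → x ≈ y → x * z ≈ y * z
    *-congʳ z refl = refl
    *-congʳ z (sym p) = sym (*-congʳ z p)
    *-congʳ z (trans p q) = trans (*-congʳ z p) (*-congʳ z q)
    *-congʳ z (+-cong p q) = +-cong (*-congʳ z p) (*-congʳ z q)
    *-congʳ z (-‿cong p) = -‿cong (*-congʳ z p)
    *-congʳ z (+-assoc _ _ _) = +-assoc _ _ _
    *-congʳ z (+-comm _ _) = +-comm _ _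
    *-congʳ z (+-identityˡ _) = +-identityˡ _
    *-congʳ z (-‿inverseˡ _) = -‿inverseˡ _
    *-congʳ z (⊗-cong p q) = leftMul-⊗-cong p q z
    *-congʳ z (⊗-distribʳ a a′ b) = leftMul-distribʳ a a′ b z
    *-congʳ z (⊗-distribˡ a b b′) = leftMul-distribˡ a b b′ z
    *-congʳ z (balanced e a b) = leftMul-balanced e a b z

    *-congˡ : ∀ x {y z} → y ≈ z → x * y ≈ x * z
    *-congˡ 0#      p = refl
    *-congˡ (x + y) p = +-cong (*-congˡ x p) (*-congˡ y p)
    *-congˡ (- x)   p = -‿cong (*-congˡ x p)
    *-congˡ (a ⊗ b) p = leftMul-cong a b p

    leftMul-leftMul : ∀ a b c d z → leftMul (a A.* c) (b B.* d) z ≈ leftMul a b (leftMul c d z)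
    leftMul-leftMul a b c d 0#      = refl
    leftMul-leftMul a b c d (x + y) = +-cong (leftMul-leftMul a b c d x) (leftMul-leftMul a b c d y)
    leftMul-leftMul a b c d (- x)   = -‿cong (leftMul-leftMul a b c d x)
    leftMul-leftMul a b c d (e ⊗ f) = ⊗-cong (A.*-assoc a c e) (B.*-assoc b d f)

    leftMul-assoc : ∀ a b y z → leftMul a b y * z ≈ leftMul a b (y * z)
    leftMul-assoc a b 0#      z = refl
    leftMul-assoc a b (x + y) z = +-cong (leftMul-assoc a b x z) (leftMul-assoc a b y z)
    leftMul-assoc a b (- x)   z = -‿cong (leftMul-assoc a b x z)
    leftMul-assoc a b (c ⊗ d) z = leftMul-leftMul a b c d z

    *-assoc : ∀ x y z → (x * y) * z ≈ x * (y * z)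
    *-assoc 0#      y z = refl
    *-assoc (w + x) y z = +-cong (*-assoc w y z) (*-assoc x y z)
    *-assoc (- x)   y z = -‿cong (*-assoc x y z)
    *-assoc (a ⊗ b) y z = leftMul-assoc a b y z

    *-identityˡ : ∀ z → leftMul A.1# B.1# z ≈ z
    *-identityˡ 0#      = refl
    *-identityˡ (x + y) = +-cong (*-identityˡ x) (*-identityˡ y)
    *-identityˡ (- x)   = -‿cong (*-identityˡ x)
    *-identityˡ (a ⊗ b) = ⊗-cong (A.*-identityˡ a) (B.*-identityˡ b)

    *-identityʳ : ∀ z → z * (A.1# ⊗ B.1#) ≈ z
    *-identityʳ 0#      = refl
    *-identityʳ (x + y) = +-cong (*-identityʳ x) (*-identityʳ y)
    *-identityʳ (- x)   = -‿cong (*-identityʳ x)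
    *-identityʳ (a ⊗ b) = ⊗-cong (A.*-identityʳ a) (B.*-identityʳ b)

    distribˡ : ∀ x y z → x * (y + z) ≈ x * y + x * z
    distribˡ 0#      y z = sym (+-identityˡ 0#)
    distribˡ (w + x) y z = trans (+-cong (distribˡ w y z) (distribˡ x y z)) (interchange _ _ _ _)
    distribˡ (- x)   y z = trans (-‿cong (distribˡ x y z)) (sym (-‿+-comm _ _))
    distribˡ (a ⊗ b) y z = refl

  tensorRing : Ring 0ℓ 0ℓ
  tensorRing = record
    { Carrier = Carrier
    ; _≈_ = _≈_
    ; _+_ = _+_
    ; _*_ = _*_
    ; -_ = -_
    ; 0# = 0#
    ; 1# = A.1# ⊗ B.1#
    ; isRing = record
      { +-isAbelianGroup = AbelianGroup.isAbelianGroup +-abelianGroup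
      ; *-cong = λ {x} {y} {z} {w} p q → trans (*-congʳ z p) (*-congˡ y q)
      ; *-assoc = *-assoc
      ; *-identity = *-identityˡ , *-identityʳ
      ; distrib = distribˡ , λ _ _ _ → refl
      }
    }

  ι₁ : A.underlying ⟶ tensorRing
  ι₁ = mkHom {A.underlying} {tensorRing} (λ a → a ⊗ B.1#)
    (λ p → ⊗-cong p B.refl)
    (λ a a′ → ⊗-distribʳ a a′ B.1#)
    (λ a a′ → ⊗-cong A.refl (B.sym (B.*-identityˡ B.1#)))
    refl

  ι₂ : B.underlying ⟶ tensorRing
  ι₂ = mkHom {B.underlying} {tensorRing} (λ b → A.1# ⊗ b)
    (λ p → ⊗-cong A.refl p)
    (λ b b′ → ⊗-distribˡ A.1# b b′)
    (λ b b′ → ⊗-cong (A.sym (A.*-identityˡ A.1#)) B.refl)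
    refl

  ι-structure : ∀ c → ⟦ ι₁ ⟧ (⟦ A.structure ⟧ c) ≈ ⟦ ι₂ ⟧ (⟦ B.structure ⟧ c)
  ι-structure c = trans (⊗-cong (A.sym (A.*-identityˡ _)) B.refl)
    (trans (balanced c A.1# B.1#) (⊗-cong A.refl (B.*-identityʳ _)))

  ι-commute : ∀ a b → ⟦ ι₁ ⟧ a * ⟦ ι₂ ⟧ b ≈ ⟦ ι₂ ⟧ b * ⟦ ι₁ ⟧ a
  ι-commute a b = ⊗-cong (A.trans (A.*-identityʳ a) (A.sym (A.*-identityˡ a)))
                         (B.trans (B.*-identityˡ b) (B.sym (B.*-identityʳ b)))

  -- a ⊗ b ↦ f a * g b
  module _ {R : Ring 0ℓ 0ℓ} (f : A.underlying ⟶ R) (g : B.underlying ⟶ R)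
           (agree : ∀ c → Ring._≈_ R (⟦ f ⟧ (⟦ A.structure ⟧ c)) (⟦ g ⟧ (⟦ B.structure ⟧ c)))
           (commute : ∀ a b → Ring._≈_ R (Ring._*_ R (⟦ f ⟧ a) (⟦ g ⟧ b)) (Ring._*_ R (⟦ g ⟧ b) (⟦ f ⟧ a))) where
    private
      module R = Ring R
      module f = RingHomomorphism f
      module g = RingHomomorphism g
      open Algebra.Properties.Ring R using (-0#≈0#; -‿distribˡ-*; -‿distribʳ-*)

      h : Carrier → R.Carrier
      h 0#      = R.0#
      h (x + y) = h x R.+ h y
      h (- x)   = R.- h x
      h (a ⊗ b) = ⟦ f ⟧ a R.* ⟦ g ⟧ b

      h-cong : ∀ {x y} → x ≈ y → h x R.≈ h y
      h-cong refl = R.refl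
      h-cong (sym p) = R.sym (h-cong p)
      h-cong (trans p q) = R.trans (h-cong p) (h-cong q)
      h-cong (+-cong p q) = R.+-cong (h-cong p) (h-cong q)
      h-cong (-‿cong p) = R.-‿cong (h-cong p)
      h-cong (+-assoc x y z) = R.+-assoc _ _ _
      h-cong (+-comm x y) = R.+-comm _ _
      h-cong (+-identityˡ x) = R.+-identityˡ _
      h-cong (-‿inverseˡ x) = R.-‿inverseˡ _
      h-cong (⊗-cong p q) = R.*-cong (f.⟦⟧-cong p) (g.⟦⟧-cong q)
      h-cong (⊗-distribʳ a a′ b) = R.trans (R.*-congʳ (f.+-homo a a′)) (R.distribʳ _ _ _)
      h-cong (⊗-distribˡ a b b′) = R.trans (R.*-congˡ (g.+-homo b b′)) (R.distribˡ _ _ _)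
      h-cong (balanced c a b) =
        R.trans (R.*-congʳ (R.trans (f.*-homo a _) (R.*-congˡ (agree c))))
        (R.trans (R.*-assoc _ _ _) (R.*-congˡ (R.sym (g.*-homo _ b))))

      leftMul-homo : ∀ a b z → h (leftMul a b z) R.≈ (⟦ f ⟧ a R.* ⟦ g ⟧ b) R.* h z
      leftMul-homo a b 0#      = R.sym (R.zeroʳ _)
      leftMul-homo a b (x + y) = R.trans (R.+-cong (leftMul-homo a b x) (leftMul-homo a b y)) (R.sym (R.distribˡ _ _ _))
      leftMul-homo a b (- x)   = R.trans (R.-‿cong (leftMul-homo a b x)) (-‿distribʳ-* _ _)
      leftMul-homo a b (c ⊗ d) = begin
        ⟦ f ⟧ (a A.* c) R.* ⟦ g ⟧ (b B.* d)                 ≈⟨ R.*-cong (f.*-homo a c) (g.*-homo b d) ⟩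
        (⟦ f ⟧ a R.* ⟦ f ⟧ c) R.* (⟦ g ⟧ b R.* ⟦ g ⟧ d)     ≈⟨ R.*-assoc _ _ _ ⟩
        ⟦ f ⟧ a R.* (⟦ f ⟧ c R.* (⟦ g ⟧ b R.* ⟦ g ⟧ d))     ≈⟨ R.*-congˡ (R.*-assoc _ _ _) ⟨
        ⟦ f ⟧ a R.* ((⟦ f ⟧ c R.* ⟦ g ⟧ b) R.* ⟦ g ⟧ d)     ≈⟨ R.*-congˡ (R.*-congʳ (commute c b)) ⟩
        ⟦ f ⟧ a R.* ((⟦ g ⟧ b R.* ⟦ f ⟧ c) R.* ⟦ g ⟧ d)     ≈⟨ R.*-congˡ (R.*-assoc _ _ _) ⟩
        ⟦ f ⟧ a R.* (⟦ g ⟧ b R.* (⟦ f ⟧ c R.* ⟦ g ⟧ d))     ≈⟨ R.*-assoc _ _ _ ⟨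
        (⟦ f ⟧ a R.* ⟦ g ⟧ b) R.* (⟦ f ⟧ c R.* ⟦ g ⟧ d)     ∎
        where open SetoidReasoning R.setoid

      *-homo : ∀ x y → h (x * y) R.≈ h x R.* h y
      *-homo 0#      y = R.sym (R.zeroˡ _)
      *-homo (w + x) y = R.trans (R.+-cong (*-homo w y) (*-homo x y)) (R.sym (R.distribʳ _ _ _))
      *-homo (- x)   y = R.trans (R.-‿cong (*-homo x y)) (-‿distribˡ-* _ _)
      *-homo (a ⊗ b) y = leftMul-homo a b y

    lift : tensorRing ⟶ R
    lift = mkHom {tensorRing} {R} h h-cong (λ _ _ → R.refl) *-homo
      (R.trans (R.*-cong f.1#-homo g.1#-homo) (R.*-identityˡ R.1#))

module _ {k C C′ : CommutativeRing 0ℓ 0ℓ} (f : ring k ⟶ ring C) (g : ring k ⟶ ring C′) where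
  private
    module C = CommutativeRing C
    module C′ = CommutativeRing C′
    open module T = Tensor (algebra {k} {C} f) (algebra {k} {C′} g)

    leftMul-comm : ∀ a b y → leftMul a b y ≈ y * (a ⊗ b)
    leftMul-comm a b 0#      = refl
    leftMul-comm a b (x + y) = +-cong (leftMul-comm a b x) (leftMul-comm a b y)
    leftMul-comm a b (- x)   = -‿cong (leftMul-comm a b x)
    leftMul-comm a b (c ⊗ d) = ⊗-cong (C.*-comm a c) (C′.*-comm b d)

    *-comm : ∀ x y → x * y ≈ y * x
    *-comm 0#      y = sym (Ring.zeroʳ tensorRing y)
    *-comm (w + x) y = trans (+-cong (*-comm w y) (*-comm x y)) (sym (Ring.distribˡ tensorRing y w x))
    *-comm (- x)   y = trans (-‿cong (*-comm x y)) (-‿distribʳ-* y x)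
      where open Algebra.Properties.Ring tensorRing using (-‿distribʳ-*)
    *-comm (a ⊗ b) y = leftMul-comm a b y

  tensorCommutativeRing : CommutativeRing 0ℓ 0ℓ
  tensorCommutativeRing = record
    { isCommutativeRing = record { isRing = Ring.isRing tensorRing ; *-comm = *-comm } }

module _ (A : Ring 0ℓ 0ℓ) where
  private module A = Ring A

  record Unit : Set where
    field
      val inv  : A.Carrier
      inverseˡ : inv A.* val A.≈ A.1#
      inverseʳ : val A.* inv A.≈ A.1#

  open Unit

  private
    cancel-middle : ∀ {w x y z} → x A.* y A.≈ A.1# → w A.* z A.≈ A.1# → (w A.* x) A.* (y A.* z) A.≈ A.1#
    cancel-middle {w} {x} {y} {z} p q = begin
      (w A.* x) A.* (y A.* z)   ≈⟨ A.*-assoc w x _ ⟩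
      w A.* (x A.* (y A.* z))   ≈⟨ A.*-congˡ (A.*-assoc x y z) ⟨
      w A.* ((x A.* y) A.* z)   ≈⟨ A.*-congˡ (A.trans (A.*-congʳ p) (A.*-identityˡ z)) ⟩
      w A.* z                   ≈⟨ q ⟩
      A.1#                      ∎
      where open SetoidReasoning A.setoid

    _·_ : Unit → Unit → Unit
    u · w = record
      { val = val u A.* val w
      ; inv = inv w A.* inv u
      ; inverseˡ = cancel-middle (inverseˡ u) (inverseˡ w)
      ; inverseʳ = cancel-middle (inverseʳ w) (inverseʳ u)
      }

    one : Unit
    one = record
      { val = A.1# ; inv = A.1#
      ; inverseˡ = A.*-identityˡ A.1# ; inverseʳ = A.*-identityˡ A.1# }

    _⁻ : Unit → Unit
    u ⁻ = record
      { val = inv u ; inv = val u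
      ; inverseˡ = inverseʳ u ; inverseʳ = inverseˡ u }

    inv-cong : ∀ u w → val u A.≈ val w → inv u A.≈ inv w
    inv-cong u w e = begin
      inv u                        ≈⟨ A.*-identityʳ _ ⟨
      inv u A.* A.1#               ≈⟨ A.*-congˡ (inverseʳ w) ⟨
      inv u A.* (val w A.* inv w)  ≈⟨ A.*-assoc _ _ _ ⟨
      (inv u A.* val w) A.* inv w  ≈⟨ A.*-congʳ (A.*-congˡ e) ⟨
      (inv u A.* val u) A.* inv w  ≈⟨ A.*-congʳ (inverseˡ u) ⟩
      A.1# A.* inv w               ≈⟨ A.*-identityˡ _ ⟩
      inv w                        ∎
      where open SetoidReasoning A.setoid

  unitSubgroup : (P : A.Carrier → Set) → P A.1# → (∀ {x y} → P x → P y → P (x A.* y)) →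
                 (∀ u → P (val u) → P (inv u)) → Group 0ℓ 0ℓ
  unitSubgroup P P-1 P-* P-inv = record
    { Carrier = Σ Unit λ u → P (val u)
    ; _≈_ = λ (u , _) (w , _) → val u A.≈ val w
    ; _∙_ = λ (u , p) (w , q) → u · w , P-* p q
    ; ε = one , P-1
    ; _⁻¹ = λ (u , p) → u ⁻ , P-inv u p
    ; isGroup = record
      { isMonoid = record
        { isSemigroup = record
          { isMagma = record
            { isEquivalence = record { refl = A.refl ; sym = A.sym ; trans = A.trans }
            ; ∙-cong = A.*-cong
            }
          ; assoc = λ _ _ _ → A.*-assoc _ _ _
          }
        ; identity = (λ _ → A.*-identityˡ _) , (λ _ → A.*-identityʳ _)
        }
      ; inverse = (λ (u , _) → inverseˡ u) , (λ (u , _) → inverseʳ u)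
      ; ⁻¹-cong = λ {(u , _)} {(w , _)} → inv-cong u w
      }
    }

open Unit public

mapUnit : ∀ {A B} → A ⟶ B → Unit A → Unit B
mapUnit {A} {B} f u = record
  { val = f.⟦ val u ⟧
  ; inv = f.⟦ inv u ⟧
  ; inverseˡ = B.trans (B.sym (f.*-homo _ _)) (B.trans (f.⟦⟧-cong (inverseˡ u)) f.1#-homo)
  ; inverseʳ = B.trans (B.sym (f.*-homo _ _)) (B.trans (f.⟦⟧-cong (inverseʳ u)) f.1#-homo)
  }
  where
  module B = Ring B
  module f = RingHomomorphism f

module Isometry (A : Ring 0ℓ 0ℓ) (star : A ⟶ Op.ring A) (h : Ring.Carrier A) where
  private
    module A = Ring A
    module star = RingHomomorphism star
    open A using (_*_; _≈_; *-congʳ; *-congˡ; *-assoc)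
    open SetoidReasoning A.setoid

  Preserves : A.Carrier → Set
  Preserves g = star.⟦ g ⟧ * h * g ≈ h

  private
    sandwich : ∀ a b g k → (a * b) * h * (g * k) ≈ a * (b * h * g) * k
    sandwich a b g k = begin
      (a * b) * h * (g * k)    ≈⟨ *-congʳ (*-assoc a b h) ⟩
      a * (b * h) * (g * k)    ≈⟨ *-assoc _ g k ⟨
      a * (b * h) * g * k      ≈⟨ *-congʳ (*-assoc a _ g) ⟩
      a * (b * h * g) * k      ∎

  preserves-1 : Preserves A.1#
  preserves-1 = begin
    star.⟦ A.1# ⟧ * h * A.1#   ≈⟨ A.*-identityʳ _ ⟩
    star.⟦ A.1# ⟧ * h          ≈⟨ *-congʳ star.1#-homo ⟩
    A.1# * h                   ≈⟨ A.*-identityˡ h ⟩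
    h                          ∎

  preserves-* : ∀ {g k} → Preserves g → Preserves k → Preserves (g * k)
  preserves-* {g} {k} p q = begin
    star.⟦ g * k ⟧ * h * (g * k)              ≈⟨ *-congʳ (*-congʳ (star.*-homo g k)) ⟩
    (star.⟦ k ⟧ * star.⟦ g ⟧) * h * (g * k)   ≈⟨ sandwich _ _ g k ⟩
    star.⟦ k ⟧ * (star.⟦ g ⟧ * h * g) * k     ≈⟨ *-congʳ (*-congˡ p) ⟩
    star.⟦ k ⟧ * h * k                        ≈⟨ q ⟩
    h                                         ∎

  preserves-inv : (u : Unit A) → Preserves (val u) → Preserves (inv u)
  preserves-inv u p = begin
    star.⟦ k ⟧ * h * k                        ≈⟨ *-congʳ (*-congˡ p) ⟨
    star.⟦ k ⟧ * (star.⟦ g ⟧ * h * g) * k     ≈⟨ sandwich _ _ g k ⟨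
    (star.⟦ k ⟧ * star.⟦ g ⟧) * h * (g * k)   ≈⟨ A.*-cong (*-congʳ (A.sym (star.*-homo g k))) (inverseʳ u) ⟩
    star.⟦ g * k ⟧ * h * A.1#                 ≈⟨ *-congʳ (*-congʳ (star.⟦⟧-cong (inverseʳ u))) ⟩
    star.⟦ A.1# ⟧ * h * A.1#                  ≈⟨ preserves-1 ⟩
    h                                         ∎
    where
    g = val u
    k = inv u

module _ (C : CommutativeRing 0ℓ 0ℓ) where
  private
    module C = CommutativeRing C
    module M = Ring (matrixRing C 3)

  private
    det-one-* : ∀ g k → det C g C.≈ C.1# → det C k C.≈ C.1# → det C (g M.* k) C.≈ C.1#
    det-one-* g k p q = C.trans (det-* C g k) (C.trans (C.*-cong p q) (C.*-identityˡ C.1#))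

    det-one-inv : (u : Unit (matrixRing C 3)) → det C (val u) C.≈ C.1# → det C (inv u) C.≈ C.1#
    det-one-inv u p = C.trans (C.sym (C.*-identityʳ _)) (C.trans (C.*-congˡ (C.sym p))
      (C.trans (C.sym (det-* C (inv u) (val u)))
      (C.trans (det-cong C {inv u M.* val u} {M.1#} (inverseˡ u)) (det-1 C))))

  specialIsometry : (conj : ring C ⟶ ring C) → M.Carrier → Group 0ℓ 0ℓ
  specialIsometry conj H = unitSubgroup (matrixRing C 3)
    (λ g → det C g C.≈ C.1# × ⟦ conjugateTranspose C conj ⟧ g M.* H M.* g M.≈ H)
    (det-1 C , I.preserves-1)
    (λ {x} {y} (p , q) (r , s) → det-one-* x y p r , I.preserves-* {x} {y} q s)
    (λ u (p , q) → det-one-inv u p , I.preserves-inv u q)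
    where module I = Isometry (matrixRing C 3) (conjugateTranspose C conj) H

M₃ℂ : Ring 0ℓ 0ℓ
M₃ℂ = matrixRing ℂ 3

private module M = Ring M₃ℂ

_ᴴ : M.Carrier → M.Carrier
g ᴴ = ⟦ conjugateTranspose ℂ ℂ.conj-homomorphism ⟧ g

IsHermitian : M.Carrier → Set
IsHermitian H = H ᴴ M.≈ H

-- An element H of GL₃(ℂ) is a unit of M₃(ℂ).
module _ (H : Unit M₃ℂ) where
  SU₃ : Group 0ℓ 0ℓ
  SU₃ = specialIsometry ℂ ℂ.conj-homomorphism (val H)

  private module SU₃ = Group SU₃

  matrix : SU₃.Carrier → M.Carrier
  matrix (u , _) = val u

  adjoint : M.Carrier → M.Carrier
  adjoint g = inv H M.* g ᴴ M.* val H

  IsReflection : SU₃.Carrier → Set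
  IsReflection R = ¬ (R SU₃.≈ SU₃.ε) × R SU₃.∙ R SU₃.≈ SU₃.ε

  IsHermitianElement : SU₃.Carrier → Set
  IsHermitianElement g = adjoint (matrix g) M.≈ matrix g

  IsSkewHermitianElement : SU₃.Carrier → Set
  IsSkewHermitianElement g = adjoint (matrix g) M.≈ M.- matrix g

-- Equality in the fields and division algebras below is not assumed decidable,
-- so an inverse is given for every x with ¬ (x ≈ 0).
IsDivisionRing : Ring 0ℓ 0ℓ → Set
IsDivisionRing R = ¬ (1# ≈ 0#) × (∀ x → ¬ (x ≈ 0#) → ∃ λ y → y * x ≈ 1# × x * y ≈ 1#)
  where open Ring R

record Field : Set₁ where
  field
    commutativeRing : CommutativeRing 0ℓ 0ℓ
    isDivisionRing  : IsDivisionRing (ring commutativeRing)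
  open CommutativeRing commutativeRing public hiding (ring)

IsBasis : ∀ {k n} (A : Algebra k) → (Fin n → Algebra.Carrier A) → Set
IsBasis {k} {n} A b =
  (∀ x → ∃ λ (c : Fin n → k.Carrier) → x ≈ combination c) ×
  (∀ c → combination c ≈ 0# → ∀ i → c i k.≈ k.0#)
  where
  module k = CommutativeRing k
  open Algebra A
  open Algebra.Properties.Semiring.Sum semiring using (sum)
  combination : (Fin n → k.Carrier) → Carrier
  combination c = sum (λ i → ⟦ structure ⟧ (c i) * b i)

record NumberField : Set₁ where
  field
    underlyingField : Field
  open Field underlyingField public
  field
    fromℚ   : ring ℚ.+-*-commutativeRing ⟶ ring commutativeRing
    degree  : ℕ
    basis   : Fin degree → Carrier
    isBasis : IsBasis (algebra {ℚ.+-*-commutativeRing} {commutativeRing} fromℚ) basis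

record QuadraticExtension (F : NumberField) : Set₁ where
  private module F = NumberField F
  field
    underlyingField : Field
  open Field underlyingField public
  field
    inclusion : ring F.commutativeRing ⟶ ring commutativeRing
    basis     : Fin 2 → Carrier
    isBasis   : IsBasis (algebra {F.commutativeRing} {commutativeRing} inclusion) basis

-- The non-trivial element of Gal(E/F).
record Conjugation {F} (E : QuadraticExtension F) : Set where
  private
    module F = NumberField F
    module E = QuadraticExtension E
  field
    τ                 : E.Carrier → E.Carrier
    isRingIsomorphism : IsRingIsomorphism E.rawRing E.rawRing τ
    fixes-F           : ∀ x → τ (⟦ E.inclusion ⟧ x) E.≈ ⟦ E.inclusion ⟧ x
    nontrivial        : ¬ (∀ x → τ x E.≈ x)

-- Degree three means dimension nine over the centre.
record CubicDivisionAlgebra (E : Field) : Set₁ where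
  private module E = Field E
  field
    algebraOver    : Algebra E.commutativeRing
  open Algebra algebraOver public
  field
    isDivisionRing : IsDivisionRing underlying
    centre         : ∀ z → (∀ x → z * x ≈ x * z) → ∃ λ c → z ≈ ⟦ structure ⟧ c
    basis          : Fin 9 → Carrier
    isBasis        : IsBasis algebraOver basis

record SecondKindInvolution {F} {E : QuadraticExtension F} (τ : Conjugation E)
  (D : CubicDivisionAlgebra (QuadraticExtension.underlyingField E)) : Set where
  private
    module D = CubicDivisionAlgebra D
  field
    antiHomomorphism : D.underlying ⟶ Op.ring D.underlying
    involutive       : ∀ x → ⟦ antiHomomorphism ⟧ (⟦ antiHomomorphism ⟧ x) D.≈ x
    on-centre        : ∀ c → ⟦ antiHomomorphism ⟧ (⟦ D.structure ⟧ c) D.≈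
                             ⟦ D.structure ⟧ (Conjugation.τ τ c)

record DivisionAlgebraWithInvolution : Set₁ where
  field
    F : NumberField
    E : QuadraticExtension F
    τ : Conjugation E
    D : CubicDivisionAlgebra (QuadraticExtension.underlyingField E)
    α : SecondKindInvolution τ D

-- A field K ⊇ E together with an isomorphism of K-algebras D ⊗_E K ≅ M₃(K).  The
-- reduced norm of d ∈ D is defined as the determinant of the image of d ⊗ 1; it
-- lies in E and does not depend on the splitting, which always exists.
record Splitting {E : Field} (D : CubicDivisionAlgebra E) : Set₁ where
  private
    module E = Field E
    module D = CubicDivisionAlgebra D
  field
    K         : Field
  open Field K using (commutativeRing; _≈_) public
  field
    inclusion : ring E.commutativeRing ⟶ ring commutativeRing
  open Tensor D.algebraOver (algebra {E.commutativeRing} {commutativeRing} inclusion)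
    using (tensorRing; ι₁; ι₂; ι-structure) public
  field
    iso       : tensorRing ⟶ matrixRing commutativeRing 3
    isRingIsomorphism : IsRingIsomorphism (Ring.rawRing tensorRing)
                          (Ring.rawRing (matrixRing commutativeRing 3)) ⟦ iso ⟧
    linear    : ∀ c → Ring._≈_ (matrixRing commutativeRing 3)
                  (⟦ iso ⟧ (⟦ ι₂ ⟧ c)) (⟦ scalar commutativeRing ⟧ c)

  representation : D.underlying ⟶ matrixRing commutativeRing 3
  representation = _⊚_ {D.underlying} {tensorRing} {matrixRing commutativeRing 3} iso ι₁

  representation-structure : ∀ c → Ring._≈_ (matrixRing commutativeRing 3)
    (⟦ representation ⟧ (⟦ D.structure ⟧ c)) (⟦ scalar commutativeRing ⟧ (⟦ inclusion ⟧ c))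
  representation-structure c i j = Field.trans K
    (RingHomomorphism.⟦⟧-cong iso (ι-structure c) i j) (linear (⟦ inclusion ⟧ c) i j)

-- An infinite place of F is an embedding F → ℂ, with absolute value
-- x ↦ |σ(x)|; conjugate embeddings have the same absolute value, hence the
-- same completion.
InfinitePlace : NumberField → Set
InfinitePlace F = ring (NumberField.commutativeRing F) ⟶ ring ℂ

module PlaceCompletion {F : NumberField} (v : InfinitePlace F) =
  Completion (NumberField.commutativeRing F) (embedding-gauge (NumberField.commutativeRing F) v)

-- {g ∈ A^× | α(g)g = 1, det ρ(g) = 1}, for an anti-homomorphism α.
module _ (A : Ring 0ℓ 0ℓ) (α : A ⟶ Op.ring A) (S : CommutativeRing 0ℓ 0ℓ)
         (ρ : A ⟶ matrixRing S 3) where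
  private
    module A = Ring A
    module S = CommutativeRing S
    module α = RingHomomorphism α
    module ρ = RingHomomorphism ρ

    N : A.Carrier → S.Carrier
    N g = det S ρ.⟦ g ⟧

    N-* : ∀ g h → N (g A.* h) S.≈ N g S.* N h
    N-* g h = S.trans (det-cong S (ρ.*-homo g h)) (det-* S ρ.⟦ g ⟧ ρ.⟦ h ⟧)

    N-1 : N A.1# S.≈ S.1#
    N-1 = S.trans (det-cong S ρ.1#-homo) (det-1 S)

    unitary-* : ∀ {g h} → α.⟦ g ⟧ A.* g A.≈ A.1# → α.⟦ h ⟧ A.* h A.≈ A.1# →
                α.⟦ g A.* h ⟧ A.* (g A.* h) A.≈ A.1#
    unitary-* {g} {h} p q = begin
      α.⟦ g A.* h ⟧ A.* (g A.* h)              ≈⟨ A.*-congʳ (α.*-homo g h) ⟩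
      (α.⟦ h ⟧ A.* α.⟦ g ⟧) A.* (g A.* h)      ≈⟨ A.*-assoc _ _ _ ⟩
      α.⟦ h ⟧ A.* (α.⟦ g ⟧ A.* (g A.* h))      ≈⟨ A.*-congˡ (A.*-assoc _ _ _) ⟨
      α.⟦ h ⟧ A.* ((α.⟦ g ⟧ A.* g) A.* h)      ≈⟨ A.*-congˡ (A.trans (A.*-congʳ p) (A.*-identityˡ h)) ⟩
      α.⟦ h ⟧ A.* h                            ≈⟨ q ⟩
      A.1#                                     ∎
      where open SetoidReasoning A.setoid

    unitary-inv : (u : Unit A) → α.⟦ val u ⟧ A.* val u A.≈ A.1# → α.⟦ inv u ⟧ A.* inv u A.≈ A.1#
    unitary-inv u p = begin
      α.⟦ inv u ⟧ A.* inv u                              ≈⟨ A.*-congˡ (A.*-identityˡ _) ⟨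
      α.⟦ inv u ⟧ A.* (A.1# A.* inv u)                   ≈⟨ A.*-congˡ (A.*-congʳ p) ⟨
      α.⟦ inv u ⟧ A.* ((α.⟦ val u ⟧ A.* val u) A.* inv u) ≈⟨ A.*-congˡ (A.*-assoc _ _ _) ⟩
      α.⟦ inv u ⟧ A.* (α.⟦ val u ⟧ A.* (val u A.* inv u)) ≈⟨ A.*-congˡ (A.trans (A.*-congˡ (inverseʳ u)) (A.*-identityʳ _)) ⟩
      α.⟦ inv u ⟧ A.* α.⟦ val u ⟧                        ≈⟨ α.*-homo (val u) (inv u) ⟨
      α.⟦ val u A.* inv u ⟧                              ≈⟨ α.⟦⟧-cong (inverseʳ u) ⟩
      α.⟦ A.1# ⟧                                         ≈⟨ α.1#-homo ⟩
      A.1#                                               ∎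
      where open SetoidReasoning A.setoid

  specialUnitary : Group 0ℓ 0ℓ
  specialUnitary = unitSubgroup A (λ g → α.⟦ g ⟧ A.* g A.≈ A.1# × det S ρ.⟦ g ⟧ S.≈ S.1#)
    (A.trans (A.*-identityʳ _) α.1#-homo , N-1)
    (λ (p , q) (r , s) → unitary-* p r
                       , S.trans (N-* _ _) (S.trans (S.*-cong q s) (S.*-identityˡ S.1#)))
    (λ u (p , q) → unitary-inv u p
                 , S.trans (S.sym (S.*-identityʳ _)) (S.trans (S.*-congˡ (S.sym q))
                     (S.trans (S.sym (N-* (inv u) (val u)))
                     (S.trans (det-cong S (ρ.⟦⟧-cong (inverseˡ u))) N-1))))

module _ (𝔻 : DivisionAlgebraWithInvolution)
         (splitting : Splitting (DivisionAlgebraWithInvolution.D 𝔻)) where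
  open DivisionAlgebraWithInvolution 𝔻
  private
    module F = NumberField F
    module E = QuadraticExtension E
    module D = CubicDivisionAlgebra D
    module α = SecondKindInvolution α
    module K = Splitting splitting

  -- The reduced norm of d is det (representation d).
  SU : Group 0ℓ 0ℓ
  SU = specialUnitary D.underlying α.antiHomomorphism K.commutativeRing K.representation

  -- Scalar extension along F → F′, which will be a completion of F.
  module BaseChange (F′ : CommutativeRing 0ℓ 0ℓ) (F→F′ : ring F.commutativeRing ⟶ ring F′) where
    private module F′ = CommutativeRing F′

    F→K : ring F.commutativeRing ⟶ ring K.commutativeRing
    F→K = _⊚_ {ring F.commutativeRing} {ring E.commutativeRing} {ring K.commutativeRing}
            K.inclusion E.inclusion

    overF : Algebra F.commutativeRing
    overF = restrictScalars {F.commutativeRing} {E.commutativeRing} E.inclusion D.algebraOver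

    F′-algebra : Algebra F.commutativeRing
    F′-algebra = algebra {F.commutativeRing} {F′} F→F′

    module D⊗F′ = Tensor overF F′-algebra
    module K⊗F′ = Tensor (algebra {F.commutativeRing} {K.commutativeRing} F→K) F′-algebra

    D′ : Ring 0ℓ 0ℓ
    D′ = D⊗F′.tensorRing

    K′ : CommutativeRing 0ℓ 0ℓ
    K′ = tensorCommutativeRing {F.commutativeRing} {K.commutativeRing} {F′}
           F→K F→F′

    private
      module D′ = Ring D′
      module K′ = CommutativeRing K′
      module M′ = Ring (matrixRing K′ 3)

    -- α ⊗ id
    α′ : D′ ⟶ Op.ring D′
    α′ = D⊗F′.lift {Op.ring D′}
      (mkHom {D.underlying} {Op.ring D′} (λ d → ι₁.⟦ a.⟦ d ⟧ ⟧)
        (λ p → ι₁.⟦⟧-cong (a.⟦⟧-cong p))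
        (λ x y → D′.trans (ι₁.⟦⟧-cong (a.+-homo x y)) (ι₁.+-homo _ _))
        (λ x y → D′.trans (ι₁.⟦⟧-cong (a.*-homo x y)) (ι₁.*-homo _ _))
        (D′.trans (ι₁.⟦⟧-cong a.1#-homo) ι₁.1#-homo))
      (mkHom {ring F′} {Op.ring D′} ι₂.⟦_⟧
        ι₂.⟦⟧-cong
        ι₂.+-homo
        (λ x y → D′.trans (ι₂.⟦⟧-cong (F′.*-comm x y)) (ι₂.*-homo y x))
        ι₂.1#-homo)
      (λ c → D′.trans
        (ι₁.⟦⟧-cong (D.trans (α.on-centre _) (structure.⟦⟧-cong (Conjugation.fixes-F τ c))))
        (D⊗F′.ι-structure c))
      (λ d x → D′.sym (D⊗F′.ι-commute a.⟦ d ⟧ x))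
      where
      module ι₁ = RingHomomorphism D⊗F′.ι₁
      module ι₂ = RingHomomorphism D⊗F′.ι₂
      module a = RingHomomorphism α.antiHomomorphism
      module structure = RingHomomorphism D.structure

    embedK : ring K.commutativeRing ⟶ ring K′
    embedK = K⊗F′.ι₁

    representation′-ι₁ : D.underlying ⟶ matrixRing K′ 3
    representation′-ι₁ = _⊚_ {D.underlying} {matrixRing K.commutativeRing 3} {matrixRing K′ 3}
      (matrixMap {K.commutativeRing} {K′} embedK) K.representation

    -- The base change of the splitting: D ⊗_F F′ → M₃(K ⊗_F F′).
    representation′ : D′ ⟶ matrixRing K′ 3
    representation′ = D⊗F′.lift {matrixRing K′ 3}
      representation′-ι₁
      (_⊚_ {ring F′} {ring K′} {matrixRing K′ 3} (scalar K′) K⊗F′.ι₂)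
      (λ c i j → K′.trans
        (RingHomomorphism.⟦⟧-cong embedK (K.representation-structure (⟦ E.inclusion ⟧ c) i j))
        (K′.trans (matrixMap-scalar {K.commutativeRing} {K′} embedK (⟦ F→K ⟧ c) i j)
        (RingHomomorphism.⟦⟧-cong (scalar K′ {3}) (K⊗F′.ι-structure c) i j)))
      (λ d x i j → K′.sym (scalar-central K′ (⟦ K⊗F′.ι₂ ⟧ x) (⟦ representation′-ι₁ ⟧ d) i j))

    -- det (representation′ g) is the reduced norm of g over E ⊗_F F′, viewed in
    -- the extension K ⊗_F F′.
    SU′ : Group 0ℓ 0ℓ
    SU′ = specialUnitary D′ α′ K′ representation′

    -- d ↦ d ⊗ 1
    ⊗1 : Group.Carrier SU → Group.Carrier SU′
    ⊗1 (u , unitary , norm-one) =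
      mapUnit {D.underlying} {D′} D⊗F′.ι₁ u , unitary′ , norm-one′
      where
      module ι₁ = RingHomomorphism D⊗F′.ι₁
      d = val u
      unitary′ : ⟦ α′ ⟧ (⟦ D⊗F′.ι₁ ⟧ d) D′.* ⟦ D⊗F′.ι₁ ⟧ d D′.≈ D′.1#
      unitary′ = begin
        ⟦ α′ ⟧ (⟦ D⊗F′.ι₁ ⟧ d) D′.* ⟦ D⊗F′.ι₁ ⟧ d
          ≈⟨ D′.*-congʳ (D′.*-identityˡ _) ⟩
        ⟦ D⊗F′.ι₁ ⟧ (⟦ α.antiHomomorphism ⟧ d) D′.* ⟦ D⊗F′.ι₁ ⟧ d
          ≈⟨ ι₁.*-homo _ _ ⟨
        ⟦ D⊗F′.ι₁ ⟧ (⟦ α.antiHomomorphism ⟧ d D.* d)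
          ≈⟨ ι₁.⟦⟧-cong unitary ⟩
        D′.1# ∎
        where open SetoidReasoning D′.setoid
      norm-one′ : det K′ (⟦ representation′ ⟧ (⟦ D⊗F′.ι₁ ⟧ d)) K′.≈ K′.1#
      norm-one′ = begin
        det K′ (⟦ representation′ ⟧ (⟦ D⊗F′.ι₁ ⟧ d))
          ≈⟨ det-cong K′ (λ i j → M′.trans {x} {⟦ representation′-ι₁ ⟧ d M′.* M′.1#} {⟦ representation′-ι₁ ⟧ d}
               (M′.*-congˡ {⟦ representation′-ι₁ ⟧ d} {one} {M′.1#} (RingHomomorphism.1#-homo (scalar K′ {3})))
               (M′.*-identityʳ (⟦ representation′-ι₁ ⟧ d)) i j) ⟩
        det K′ (⟦ representation′-ι₁ ⟧ d)
          ≈⟨ det-matrixMap {K.commutativeRing} {K′} embedK (⟦ K.representation ⟧ d) ⟩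
        ⟦ embedK ⟧ (det K.commutativeRing (⟦ K.representation ⟧ d))
          ≈⟨ RingHomomorphism.⟦⟧-cong embedK norm-one ⟩
        ⟦ embedK ⟧ (Field.1# K.K)
          ≈⟨ RingHomomorphism.1#-homo embedK ⟩
        K′.1# ∎
        where
        open SetoidReasoning K′.setoid
        one = ⟦ scalar K′ {3} ⟧ (⟦ K⊗F′.ι₂ ⟧ F′.1#)
        x = ⟦ representation′-ι₁ ⟧ d M′.* one

  SUᵥ : InfinitePlace F → Group 0ℓ 0ℓ
  SUᵥ v = BaseChange.SU′ Fᵥ.commutativeRing Fᵥ.constant-homomorphism
    where module Fᵥ = PlaceCompletion {F} v

  embed : (v : InfinitePlace F) → Group.Carrier SU → Group.Carrier (SUᵥ v)
  embed v = BaseChange.⊗1 Fᵥ.commutativeRing Fᵥ.constant-homomorphism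
    where module Fᵥ = PlaceCompletion {F} v

{-# OPTIONS --safe #-}

-- An element g of SU₃(H) satisfies g* = g⁻¹.  Hence a hermitian g ≠ 1 is a
-- reflection, while a skew-hermitian g has g² = -1, which contradicts det g = 1.
-- If a reflection comes from d ∈ SU(D), then d² = 1 in the division ring D, so
-- d = ±1; but d = 1 maps to the identity and -1 has reduced norm -1.

module Submission where

open import Defs
open import Level using (0ℓ)
open import Algebra.Bundles using (Group; Ring; CommutativeRing)
open import Algebra.Morphism.Bundles using (RingHomomorphism)
open import Algebra.Morphism.Structures using (IsGroupIsomorphism)
import Algebra.Properties.AbelianGroup
import Algebra.Properties.Ring
import Data.Nat.Properties as ℕ
open import Data.Product.Base using (∃; _×_; _,_; proj₁)
open import Data.Rational.Base as ℚ using (½; 1ℚ)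
import Data.Rational.Properties as ℚ
open import Data.Sum.Base using (_⊎_; inj₁; inj₂)
import Relation.Binary.Reasoning.Setoid as SetoidReasoning
open import Relation.Binary.PropositionalEquality.Core using (refl)
open import Relation.Nullary.Decidable.Core using (toWitnessFalse)
open import Relation.Nullary.Negation.Core using (¬_)

-- Identities in rings and division rings.

module _ (A : Ring 0ℓ 0ℓ) where
  open Ring A hiding (refl)
  open Algebra.Properties.Ring A using (-‿distribˡ-*; -‿distribʳ-*; -‿involutive)
  open Algebra.Properties.AbelianGroup +-abelianGroup using () renaming
    (inverseˡ-unique to +-inverseˡ-unique)
  open SetoidReasoning setoid

  -x*-y≈x*y : ∀ x y → (- x) * (- y) ≈ x * y
  -x*-y≈x*y x y = begin
    (- x) * (- y)   ≈⟨ -‿distribˡ-* x (- y) ⟨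
    - (x * (- y))   ≈⟨ -‿cong (-‿distribʳ-* x y) ⟨
    - (- (x * y))   ≈⟨ -‿involutive _ ⟩
    x * y           ∎

  x-y≈0⇒x≈y : ∀ {x y} → x - y ≈ 0# → x ≈ y
  x-y≈0⇒x≈y e = trans (+-inverseˡ-unique _ _ e) (-‿involutive _)

  trivial : 1# ≈ 0# → ∀ x y → x ≈ y
  trivial e x y = trans (vanish x) (sym (vanish y))
    where
    vanish : ∀ z → z ≈ 0#
    vanish z = trans (sym (*-identityˡ z)) (trans (*-congʳ e) (zeroˡ z))

  -- Meant for `s` the conjugate transpose of `x`: the left factor is then the adjoint of `x`, so
  -- the adjoint of an isometry of `h` is a left inverse of it.
  conjugate-inverse : ∀ {h⁻¹ h s x} → h⁻¹ * h ≈ 1# → s * h * x ≈ h → (h⁻¹ * s * h) * x ≈ 1#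
  conjugate-inverse {h⁻¹} {h} {s} {x} inverse preserves = begin
    (h⁻¹ * s * h) * x     ≈⟨ *-congʳ (*-assoc h⁻¹ s h) ⟩
    (h⁻¹ * (s * h)) * x   ≈⟨ *-assoc h⁻¹ (s * h) x ⟩
    h⁻¹ * (s * h * x)     ≈⟨ *-congˡ preserves ⟩
    h⁻¹ * h               ≈⟨ inverse ⟩
    1#                    ∎

  leftInverse-resp : ∀ {x y z} → y ≈ z → y * x ≈ 1# → z * x ≈ 1#
  leftInverse-resp y≈z y*x≈1 = trans (*-congʳ (sym y≈z)) y*x≈1

  -- The factor `x - 1#` can be cancelled from `(x - 1#) * (x + 1#) ≈ 0#`. Without decidable
  -- equality, its inverse has to come from a refutation of `x ≈ 1#`; hence a hypothesis instead of
  -- a disjunction in the conclusion.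
  x²≈1⇒x≈-1 : IsDivisionRing A → ∀ {x} → x * x ≈ 1# → ¬ (x ≈ 1#) → x ≈ - 1#
  x²≈1⇒x≈-1 (_ , invert) {x} x²≈1 x≉1 with invert (x - 1#) (λ e → x≉1 (x-y≈0⇒x≈y e))
  ... | y , y[x-1]≈1 , _ = +-inverseˡ-unique x 1# (begin
    x + 1#                       ≈⟨ *-identityˡ _ ⟨
    1# * (x + 1#)                ≈⟨ *-congʳ y[x-1]≈1 ⟨
    (y * (x - 1#)) * (x + 1#)    ≈⟨ *-assoc _ _ _ ⟩
    y * ((x - 1#) * (x + 1#))    ≈⟨ *-congˡ difference-of-squares ⟩
    y * 0#                       ≈⟨ zeroʳ y ⟩
    0#                           ∎)
    where
    difference-of-squares : (x - 1#) * (x + 1#) ≈ 0#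
    difference-of-squares = begin
      (x - 1#) * (x + 1#)                   ≈⟨ distribʳ _ _ _ ⟩
      x * (x + 1#) + (- 1#) * (x + 1#)      ≈⟨ +-congˡ (-‿distribˡ-* 1# _) ⟨
      x * (x + 1#) - 1# * (x + 1#)          ≈⟨ +-cong (distribˡ x x 1#) (-‿cong (*-identityˡ _)) ⟩
      (x * x + x * 1#) - (x + 1#)           ≈⟨ +-congʳ (+-cong x²≈1 (*-identityʳ x)) ⟩
      (1# + x) - (x + 1#)                   ≈⟨ +-congʳ (+-comm 1# x) ⟩
      (x + 1#) - (x + 1#)                   ≈⟨ -‿inverseʳ _ ⟩
      0#                                    ∎

module _ {A B : Ring 0ℓ 0ℓ} (f : A ⟶ B) where
  private
    module A = Ring A
    module B = Ring B
    module f = RingHomomorphism f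
  open SetoidReasoning B.setoid

  -- If `x` and `y` differ, then `x - y` is invertible and maps to zero, which forces `1 = 0` in the
  -- target. The inverse exists only under the assumption `x≉y`, hence the double negation.
  divisionRing-injective : IsDivisionRing A → ¬ (B.1# B.≈ B.0#) →
    ∀ {x y} → f.⟦ x ⟧ B.≈ f.⟦ y ⟧ → ¬ ¬ (x A.≈ y)
  divisionRing-injective (_ , invert) 1≉0 {x} {y} fx≈fy x≉y
    with invert (x A.- y) (λ e → x≉y (x-y≈0⇒x≈y A e))
  ... | z , z[x-y]≈1 , _ = 1≉0 (begin
    B.1#                              ≈⟨ f.1#-homo ⟨
    f.⟦ A.1# ⟧                        ≈⟨ f.⟦⟧-cong z[x-y]≈1 ⟨
    f.⟦ z A.* (x A.- y) ⟧             ≈⟨ f.*-homo _ _ ⟩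
    f.⟦ z ⟧ B.* f.⟦ x A.- y ⟧         ≈⟨ B.*-congˡ (f.+-homo _ _) ⟩
    f.⟦ z ⟧ B.* (f.⟦ x ⟧ B.+ f.⟦ A.- y ⟧)   ≈⟨ B.*-congˡ (B.+-cong fx≈fy (f.-‿homo y)) ⟩
    f.⟦ z ⟧ B.* (f.⟦ y ⟧ B.- f.⟦ y ⟧) ≈⟨ B.*-congˡ (B.-‿inverseʳ _) ⟩
    f.⟦ z ⟧ B.* B.0#                  ≈⟨ B.zeroʳ _ ⟩
    B.0#                              ∎)

-- Signs of 3 by 3 determinants.

module _ (C : CommutativeRing 0ℓ 0ℓ) where
  private
    module C = CommutativeRing C
    module M = Ring (matrixRing C 3)
  open Algebra.Properties.Ring C.ring using (-‿distribˡ-*; -‿+-comm)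

  -- The size is odd: in the expansion along the first row the quadratic minors keep their sign and
  -- the entries in front of them change it.
  det-neg : ∀ M → det C (M.- M) C.≈ C.- det C M
  det-neg M = C.trans
    (C.+-cong (C.trans (C.+-cong (term _ _ _ _ _) (C.-‿cong (term _ _ _ _ _))) (-‿+-comm _ _))
              (term _ _ _ _ _))
    (-‿+-comm _ _)
    where
    term : ∀ a x y z w →
      (C.- a) C.* ((C.- x) C.* (C.- y) C.- (C.- z) C.* (C.- w)) C.≈
      C.- (a C.* (x C.* y C.- z C.* w))
    term a x y z w = C.trans
      (C.*-congˡ (C.+-cong (-x*-y≈x*y C.ring x y) (C.-‿cong (-x*-y≈x*y C.ring z w))))
      (C.sym (-‿distribˡ-* a _))

  -- Take determinants on both sides of `(- x) * x ≈ 1#`; by `det-neg` the left side has determinant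
  -- `-1`.
  det≈1∧-x*x≈1⇒-1≈1 : ∀ x → det C x C.≈ C.1# → (M.- x) M.* x M.≈ M.1# → C.- C.1# C.≈ C.1#
  det≈1∧-x*x≈1⇒-1≈1 x det≈1 -x*x≈1 = begin
    C.- C.1#                    ≈⟨ C.-‿cong det≈1 ⟨
    C.- det C x                 ≈⟨ det-neg x ⟨
    det C (M.- x)               ≈⟨ C.*-identityʳ _ ⟨
    det C (M.- x) C.* C.1#      ≈⟨ C.*-congˡ det≈1 ⟨
    det C (M.- x) C.* det C x   ≈⟨ det-* C (M.- x) x ⟨
    det C ((M.- x) M.* x)       ≈⟨ det-cong C {(M.- x) M.* x} {M.1#} -x*x≈1 ⟩
    det C M.1#                  ≈⟨ det-1 C ⟩
    C.1#                        ∎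
    where open SetoidReasoning C.setoid

-- The adjoint on special isometry groups.

module _ (C : CommutativeRing 0ℓ 0ℓ) (conj : ring C ⟶ ring C) (H : Unit (matrixRing C 3)) where
  private
    module C = CommutativeRing C
    module M = Ring (matrixRing C 3)
    module G = Group (specialIsometry C conj (val H))

  -- The formula of `adjoint` over an arbitrary commutative ring with conjugation, so that the
  -- arguments about it treat matrix entries abstractly.
  adjointMatrix : M.Carrier → M.Carrier
  adjointMatrix x = inv H M.* ⟦ conjugateTranspose C conj ⟧ x M.* val H

  adjoint-inverse : ((u , _) : G.Carrier) → adjointMatrix (val u) M.* val u M.≈ M.1#
  adjoint-inverse (u , _ , preserves) = conjugate-inverse (matrixRing C 3)
    {inv H} {val H} {⟦ conjugateTranspose C conj ⟧ (val u)} {val u} (inverseˡ H) preserves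

  selfAdjoint⇒involution : (g@(u , _) : G.Carrier) → adjointMatrix (val u) M.≈ val u → g G.∙ g G.≈ G.ε
  selfAdjoint⇒involution g@(u , _) selfAdjoint =
    leftInverse-resp (matrixRing C 3) {val u} {adjointMatrix (val u)} {val u} selfAdjoint (adjoint-inverse g)

  skewAdjoint⇒-1≈1 : ((u , _) : G.Carrier) → adjointMatrix (val u) M.≈ M.- val u → C.- C.1# C.≈ C.1#
  skewAdjoint⇒-1≈1 g@(u , det≈1 , _) skew = det≈1∧-x*x≈1⇒-1≈1 C (val u) det≈1
    (leftInverse-resp (matrixRing C 3) {val u} {adjointMatrix (val u)} {M.- val u} skew (adjoint-inverse g))

-- The elements 1 and -1 are distinct.

-1≉1-ℂ : (let open CommutativeRing ℂ) → ¬ (- 1# ≈ 1#)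
-- The real parts are constant sequences at distance 2, so they never come within the tolerance 1.
-1≉1-ℂ (ℂ.eq (ℝ.lim null) _) with null 1ℚ (ℚ.positive⁻¹ 1ℚ)
... | N , small = toWitnessFalse {a? = 2ℚ ℚ.<? 1ℚ} _ (small N ℕ.≤-refl)

-- The image of `½` inverts 2, so `1 + 1 = 0` would give `1 = 0`.
-1≉1-char0 : (K : Field) (let open Field K) →
  ring ℚ.+-*-commutativeRing ⟶ ring commutativeRing → ¬ (- 1# ≈ 1#)
-1≉1-char0 K h -1≈1 = proj₁ isDivisionRing (begin
  1#                              ≈⟨ h.1#-homo ⟨
  h.⟦ ½ ℚ.* (1ℚ ℚ.+ 1ℚ) ⟧         ≈⟨ h.*-homo ½ (1ℚ ℚ.+ 1ℚ) ⟩
  h.⟦ ½ ⟧ * h.⟦ 1ℚ ℚ.+ 1ℚ ⟧       ≈⟨ *-congˡ (h.+-homo 1ℚ 1ℚ) ⟩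
  h.⟦ ½ ⟧ * (h.⟦ 1ℚ ⟧ + h.⟦ 1ℚ ⟧) ≈⟨ *-congˡ (+-cong h.1#-homo h.1#-homo) ⟩
  h.⟦ ½ ⟧ * (1# + 1#)             ≈⟨ *-congˡ (+-congʳ -1≈1) ⟨
  h.⟦ ½ ⟧ * (- 1# + 1#)           ≈⟨ *-congˡ (-‿inverseˡ 1#) ⟩
  h.⟦ ½ ⟧ * 0#                    ≈⟨ zeroʳ _ ⟩
  0#                              ∎)
  where
  open Field K hiding (refl)
  module h = RingHomomorphism h
  open SetoidReasoning setoid

-- Hermitian and skew-hermitian elements over the complex numbers.

module _ (H : Unit M₃ℂ) where
  private
    module C = CommutativeRing ℂ
    module M = Ring M₃ℂ
    module G = Group (SU₃ H)

    ≈-trans : ∀ {x y z} → x C.≈ y → y C.≈ z → x C.≈ z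
    ≈-trans {x} {y} {z} = C.trans {x} {y} {z}

    adjoint′ : M.Carrier → M.Carrier
    adjoint′ = adjointMatrix ℂ ℂ.conj-homomorphism H

  -- The two sides are definitionally equal, but a direct check would also
  -- compare the proofs that the entries are Cauchy, which does not terminate in
  -- reasonable time.
  adjoint-agrees : (g : G.Carrier) → ∀ i j → adjoint′ (val (proj₁ g)) i j C.≈ adjoint H (matrix H g) i j
  adjoint-agrees g i j = ℂ.eq (ℝ.pointwise λ n → refl) (ℝ.pointwise λ n → refl)

  hermitian⇒involution : (g : G.Carrier) → IsHermitianElement H g → g G.∙ g G.≈ G.ε
  hermitian⇒involution g hermitian = selfAdjoint⇒involution ℂ ℂ.conj-homomorphism H g
    (λ i j → ≈-trans (adjoint-agrees g i j) (hermitian i j))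

  ¬skewHermitian : (g : G.Carrier) → ¬ IsSkewHermitianElement H g
  ¬skewHermitian g skew = -1≉1-ℂ (skewAdjoint⇒-1≈1 ℂ ℂ.conj-homomorphism H g
    (λ i j → ≈-trans (adjoint-agrees g i j) (skew i j)))

-- Involutions in `SU(D)` and their images in `SU(D_v)`.

module _ (𝔻 : DivisionAlgebraWithInvolution)
         (splitting : Splitting (DivisionAlgebraWithInvolution.D 𝔻)) where
  open DivisionAlgebraWithInvolution 𝔻
  private
    module F = NumberField F
    module E = QuadraticExtension E
    module D = CubicDivisionAlgebra D
    module K = Splitting splitting
    module Kf = Field K.K
    module ρ = RingHomomorphism K.representation
    module M = Ring (matrixRing K.commutativeRing 3)
    module S = Group (SU 𝔻 splitting)

  -- Once `d ≈ 1` is refuted, `d` must be -1, whose reduced norm is the determinant of minus the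
  -- identity matrix. The double negation is enough, since it is used only to derive contradictions.
  involution⇒trivial : (d : S.Carrier) → d S.∙ d S.≈ S.ε → ¬ ¬ (d S.≈ S.ε)
  involution⇒trivial (u , _ , norm≈1) d²≈1 d≉1 =
    -- The splitting field has characteristic zero through `ℚ → F → E → K`.
    -1≉1-char0 K.K (_⊚_ {ring ℚ.+-*-commutativeRing} {ring E.commutativeRing} {ring K.commutativeRing}
      K.inclusion (_⊚_ {ring ℚ.+-*-commutativeRing} {ring F.commutativeRing} {ring E.commutativeRing}
        E.inclusion F.fromℚ))
      (begin
        Kf.- Kf.1#                          ≈⟨ Kf.-‿cong (det-1 K.commutativeRing) ⟨
        Kf.- det K.commutativeRing M.1#     ≈⟨ det-neg K.commutativeRing M.1# ⟨
        det K.commutativeRing (M.- M.1#)    ≈⟨ det-cong K.commutativeRing {ρ.⟦ x ⟧} {M.- M.1#} ρx≈-1 ⟨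
        det K.commutativeRing ρ.⟦ x ⟧       ≈⟨ norm≈1 ⟩
        Kf.1#                               ∎)
    where
    open SetoidReasoning Kf.setoid
    x = val u
    ρx≈-1 : ρ.⟦ x ⟧ M.≈ M.- M.1#
    ρx≈-1 = M.trans {ρ.⟦ x ⟧} {ρ.⟦ D.- D.1# ⟧} {M.- M.1#}
      (ρ.⟦⟧-cong (x²≈1⇒x≈-1 D.underlying D.isDivisionRing d²≈1 d≉1))
      (M.trans {ρ.⟦ D.- D.1# ⟧} {M.- ρ.⟦ D.1# ⟧} {M.- M.1#} (ρ.-‿homo D.1#)
        (M.-‿cong {ρ.⟦ D.1# ⟧} {M.1#} ρ.1#-homo))

  module _ (v : InfinitePlace F) where
    private
      module Fᵥ = PlaceCompletion {F} v
      module B = BaseChange 𝔻 splitting Fᵥ.commutativeRing Fᵥ.constant-homomorphism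
      module D′ = Ring B.D′
      module Sᵥ = Group (SUᵥ 𝔻 splitting v)

    -- The algebra `D_v` may have zero divisors, so the equation `e² = 1` is pulled back along
    -- `D → D_v` and solved in the division ring `D`.
    embed-involution⇒trivial : (d : S.Carrier) →
      embed 𝔻 splitting v d Sᵥ.∙ embed 𝔻 splitting v d Sᵥ.≈ Sᵥ.ε →
      ¬ ¬ (embed 𝔻 splitting v d Sᵥ.≈ Sᵥ.ε)
    embed-involution⇒trivial d@(u , _) e²≈1 e≉1 =
      divisionRing-injective {D.underlying} {B.D′} ι D.isDivisionRing
        -- That `D_v` is nonzero follows from `e≉1`, because all elements of the zero ring are
        -- equal.
        (λ 1≈0 → e≉1 (trivial B.D′ 1≈0 _ _))
        (D′.trans (ι.*-homo (val u) (val u)) (D′.trans e²≈1 (D′.sym ι.1#-homo)))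
        (λ d²≈1 → involution⇒trivial d d²≈1
          (λ d≈1 → e≉1 (D′.trans (ι.⟦⟧-cong d≈1) ι.1#-homo)))
      where
      ι = B.D⊗F′.ι₁
      module ι = RingHomomorphism ι

corollary1p2 : (H : Unit M₃ℂ) → IsHermitian (val H) →
    (𝔻 : DivisionAlgebraWithInvolution)
    (splitting : Splitting (DivisionAlgebraWithInvolution.D 𝔻))
    (v : InfinitePlace (DivisionAlgebraWithInvolution.F 𝔻))
    (φ : Group.Carrier (SUᵥ 𝔻 splitting v) → Group.Carrier (SU₃ H)) →
    IsGroupIsomorphism (Group.rawGroup (SUᵥ 𝔻 splitting v)) (Group.rawGroup (SU₃ H)) φ →
    ((R : Group.Carrier (SU₃ H)) → IsReflection H R →
    ¬ (∃ λ (d : Group.Carrier (SU 𝔻 splitting)) → Group._≈_ (SU₃ H) (φ (embed 𝔻 splitting v d)) R))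
    ×
    ((g : Group.Carrier (SU₃ H)) →
    IsHermitianElement H g ⊎ IsSkewHermitianElement H g →
    ¬ (Group._≈_ (SU₃ H) g (Group.ε (SU₃ H))) →
    ¬ (∃ λ (d : Group.Carrier (SU 𝔻 splitting)) → Group._≈_ (SU₃ H) (φ (embed 𝔻 splitting v d)) g))
corollary1p2 H _ 𝔻 splitting v φ iso = reflection , λ
  { g (inj₁ hermitian) g≉1 → reflection g (g≉1 , hermitian⇒involution H g hermitian)
  ; g (inj₂ skew) _ _      → ¬skewHermitian H g skew
  }
  where
  module G = Group (SU₃ H)
  module Sᵥ = Group (SUᵥ 𝔻 splitting v)
  module φ = IsGroupIsomorphism iso

  -- Injectivity of `φ` carries `R² = 1` back to `e² = 1`, where `e` is the image of `d` in
  -- `SU(D_v)`; and `e ≈ 1` would give `R ≈ 1`.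
  reflection : (R : G.Carrier) → IsReflection H R →
    ¬ (∃ λ (d : Group.Carrier (SU 𝔻 splitting)) → φ (embed 𝔻 splitting v d) G.≈ R)
  reflection R (R≉1 , R²≈1) (d , φe≈R) = embed-involution⇒trivial 𝔻 splitting v d
    (φ.injective {e Sᵥ.∙ e} {Sᵥ.ε} (begin
      φ (e Sᵥ.∙ e)   ≈⟨ φ.∙-homo e e ⟩
      φ e G.∙ φ e    ≈⟨ G.∙-cong {φ e} {R} {φ e} {R} φe≈R φe≈R ⟩
      R G.∙ R        ≈⟨ R²≈1 ⟩
      G.ε            ≈⟨ φ.ε-homo ⟨
      φ Sᵥ.ε         ∎))
    (λ e≈1 → R≉1 (begin
      R              ≈⟨ φe≈R ⟨
      φ e            ≈⟨ φ.⟦⟧-cong {e} {Sᵥ.ε} e≈1 ⟩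
      φ Sᵥ.ε         ≈⟨ φ.ε-homo ⟩
      G.ε            ∎))
    where
    open SetoidReasoning G.setoid
    e = embed 𝔻 splitting v d
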